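{- Let $G$ be a loopless multigraph with $n$ vertices and pseudo-arboricity $a^*$, let $\varepsilon \in (0,1)$ and $t = \lfloor (2 + \varepsilon) a^* \rfloor$. There are deterministic $O\left( \frac{\log n}{\varepsilon}\right)$-round LOCAL algorithms to obtain the following decompositions of $G$: 1. A partition of the vertices into $k = O\left(\frac{\log n}{\varepsilon}\right)$ classes $H_1, \dots, H_k$, such that each vertex $v \in H_i$ has at most $t$ neighbors in $H_i \cup \dots \cup H_k$. 2. An orientation of the edges such that the resulting directed graph is acyclic and each vertex has outdegree at most $t$. 3. A $3t$-star-forest decomposition. 4. A list-forest decomposition when every edge has a palette of size $t$.
   Context: A pseudo-forest is a graph with at most one cycle in each connected component; the pseudo-arboricity $a^*$ is the minimum number of pseudo-forests into which the edges of $G$ can be partitioned; equivalently $a^* = \max_{H \subseteq G, |V(H)| \geq 1} \lceil |E(H)|/|V(H)| \rceil$. A star-forest is a forest whose connected components are stars; a $k$-star-forest decomposition is a partition of the edges into (at most) $k$ star-forests. If each edge $e$ has a palette (set) of colors $Q(e)$, a list-forest decomposition is a choice of color $\phi(e) \in Q(e)$ for every edge $e$ such that for each color $c$ the edges of color $c$ form a forest. LOCAL model: the input graph is the communication network; the vertices operate in synchronized rounds, in each of which every vertex exchanges messages of arbitrary size with its neighbors and performs arbitrary local computation. Each vertex has a unique ID, a binary string of length $O(\log n)$, and knows the palettes (if any) of its incident edges. Equivalently, in an $r$-round algorithm each vertex computes its output from the information in its $r$-hop neighborhood. Global parameters such as $n, a^*, \varepsilon$ are known to all vertices (technically, as given upper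 bounds, to which the symbols then refer). Constants in $O(\cdot)$ are universal. -}

module Defs where

open import Data.Bool using (Bool; true)
open import Data.Fin as Fin using (Fin)
import Data.Fin.Properties as Fin
open import Data.Integer using (+_)
open import Data.List using (List; []; _∷_; length; filter; allFin)
open import Data.List.Membership.Propositional using (_∈_)
open import Data.List.Relation.Unary.Unique.Propositional using (Unique)
open import Data.Maybe using (Maybe; just)
open import Data.Nat as ℕ using (ℕ; zero; suc; _≤_)
open import Data.Nat.Logarithm using (⌈log₂_⌉)
open import Data.Product using (Σ; ∃; ∃-syntax; _×_; _,_; proj₁; proj₂)
open import Data.Rational as ℚ using (ℚ)
open import Data.Sum using (_⊎_; swap)
open import Function.Bundles using (_⇔_)
open import Function.Definitions using (Injective)
open import Relation.Binary.Construct.Closure.Transitive using (TransClosure)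
open import Relation.Binary.PropositionalEquality using (_≡_; _≢_)
open import Relation.Nullary using (¬_)
open import Relation.Nullary.Decidable using (_×-dec_; _⊎-dec_)
open import Relation.Unary using (Decidable)

-- Two-sided, located Dedekind cuts
record ℝ : Set₁ where
  field
    lower upper     : ℚ → Set
    lower-inhabited : ∃ lower
    upper-inhabited : ∃ upper
    lower-rounded   : ∀ q → lower q ⇔ (∃[ r ] (q ℚ.< r × lower r))
    upper-rounded   : ∀ q → upper q ⇔ (∃[ r ] (r ℚ.< q × upper r))
    disjoint        : ∀ q → ¬ (lower q × upper q)
    located         : ∀ q r → q ℚ.< r → lower q ⊎ upper r

infix 4 _<ℝ_ _ℝ<_

_<ℝ_ : ℚ → ℝ → Set
q <ℝ x = ℝ.lower x q

_ℝ<_ : ℝ → ℚ → Set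
x ℝ< q = ℝ.upper x q

fromℕ : ℕ → ℚ
fromℕ m = (+ m) ℚ./ 1

-- t = ⌊(2 + ε) a⌋, that is t ≤ (2 + ε) a < t + 1.  As q ↦ (2 + q) a is
-- monotone and continuous, comparisons with (2 + ε) a are comparisons
-- with (2 + q) a for rational q > ε.
IsFloor : ℕ → ℝ → ℕ → Set
IsFloor t ε a =
    (∀ q → ε ℝ< q → fromℕ t ℚ.≤ (fromℕ 2 ℚ.+ q) ℚ.* fromℕ a)
  × (∃[ q ] (ε ℝ< q × (fromℕ 2 ℚ.+ q) ℚ.* fromℕ a ℚ.< fromℕ (suc t)))

-- Equal to ⌈log₂ n⌉ for n ≥ 2; it is 1 for n ≤ 1, where a bound such as
-- k = O(log n) would otherwise leave no class for the only vertex.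
log : ℕ → ℕ
log n = ⌈log₂ (2 ℕ.⊔ n) ⌉

-- r ≤ C · log n / ε for ε > 0, that is r · ε ≤ C · log n.
Within : ℕ → ℕ → ℝ → ℕ → Set
Within C n ε r = ∀ q → q <ℝ ε → fromℕ r ℚ.* q ℚ.≤ fromℕ (C ℕ.* log n)

-- The order of the two ends of an edge carries no meaning.
record Multigraph : Set where
  field
    order size : ℕ
    ends       : Fin size → Fin order × Fin order
    loopless   : ∀ e → proj₁ (ends e) ≢ proj₂ (ends e)

  Vertex Edge : Set
  Vertex = Fin order
  Edge   = Fin size

  Joins : Edge → Vertex → Vertex → Set
  Joins e u w = (ends e ≡ (u , w)) ⊎ (ends e ≡ (w , u))

  Incident : Vertex → Edge → Set
  Incident v e = (v ≡ proj₁ (ends e)) ⊎ (v ≡ proj₂ (ends e))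

  incident? : ∀ v → Decidable (Incident v)
  incident? v e = (v Fin.≟ proj₁ (ends e)) ⊎-dec (v Fin.≟ proj₂ (ends e))

# : ∀ {m} {P : Fin m → Set} → Decidable P → ℕ
# {m} P? = length (filter P? (allFin m))

module _ (G : Multigraph) where
  open Multigraph G

  EdgeSet : Set₁
  EdgeSet = Edge → Set

  Class : {A : Set} → (Edge → A) → A → EdgeSet
  Class φ c e = φ e ≡ c

  data Walk (F : EdgeSet) : Vertex → Vertex → Set where
    stop : ∀ {u} → Walk F u u
    step : ∀ {u w v} (e : Edge) → F e → Joins e u w → Walk F w v → Walk F u v

  module _ {F : EdgeSet} where

    edges : ∀ {u v} → Walk F u v → List Edge
    edges stop           = []
    edges (step e _ _ p) = e ∷ edges p

    -- The final vertex is omitted, so a closed walk lists its base once.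
    vertices : ∀ {u v} → Walk F u v → List Vertex
    vertices stop                   = []
    vertices (step {u = u} _ _ _ p) = u ∷ vertices p

    -- Two parallel edges form a cycle; one edge walked back and forth
    -- does not.
    IsCycle : ∀ {u} → Walk F u u → Set
    IsCycle p = edges p ≢ [] × Unique (vertices p) × Unique (edges p)

    SameCycle : ∀ {u v} → Walk F u u → Walk F v v → Set
    SameCycle p q = ∀ e → (e ∈ edges p) ⇔ (e ∈ edges q)

  -- A set F of edges stands for the spanning subgraph (V, F).

  IsForest : EdgeSet → Set
  IsForest F = ∀ {u} (p : Walk F u u) → ¬ IsCycle p

  IsPseudoForest : EdgeSet → Set
  IsPseudoForest F = ∀ {u v} (p : Walk F u u) (q : Walk F v v) →
    IsCycle p → IsCycle q → Walk F u v → SameCycle p q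

  -- The component of every vertex v has a vertex c, the centre, incident to
  -- all edges of that component.
  IsStarForest : EdgeSet → Set
  IsStarForest F = IsForest F ×
    (∀ v → ∃[ c ] (Walk F v c ×
      (∀ e x → F e → Incident x e → Walk F v x → Incident c e)))

  HasPseudoForestPartition : ℕ → Set
  HasPseudoForestPartition k =
    Σ (Edge → Fin k) λ φ → ∀ c → IsPseudoForest (Class φ c)

  IsPseudoArboricity : ℕ → Set
  IsPseudoArboricity k = HasPseudoForestPartition k
                       × (∀ j → HasPseudoForestPartition j → k ≤ j)

  -- Class Hᵢ is { v | h v ≡ i }.  For v ∈ Hᵢ the neighbours in Hᵢ ∪ … ∪ Hₖ
  -- are counted with multiplicity, by the edges at v inside Hᵢ ∪ … ∪ Hₖ.
  IsHPartition : ∀ {k} → ℕ → (Vertex → Fin k) → Set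
  IsHPartition t h = ∀ v → # (laterEdge? v) ≤ t
    where
    laterEdge? : ∀ v → Decidable (λ e → Incident v e
                   × h v Fin.≤ h (proj₁ (ends e)) × h v Fin.≤ h (proj₂ (ends e)))
    laterEdge? v e = incident? v e
      ×-dec (h v Fin.≤? h (proj₁ (ends e))) ×-dec (h v Fin.≤? h (proj₂ (ends e)))

  record Orientation : Set where
    field
      tail head : Edge → Vertex
      joins     : ∀ e → Joins e (tail e) (head e)

    Arc : Vertex → Vertex → Set
    Arc x y = ∃[ e ] (tail e ≡ x × head e ≡ y)

    Acyclic : Set
    Acyclic = ∀ v → ¬ TransClosure Arc v v

    outdegree : Vertex → ℕ
    outdegree v = # (λ e → tail e Fin.≟ v)

  IsStarForestDecomposition : ∀ {k} → (Edge → Fin k) → Set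
  IsStarForestDecomposition φ = ∀ c → IsStarForest (Class φ c)

  IsListForestDecomposition : {Color : Set} →
    (Edge → List Color) → (Edge → Color) → Set
  IsListForestDecomposition Q φ =
    (∀ e → φ e ∈ Q e) × (∀ c → IsForest (Class φ c))

ID : Set
ID = List Bool

-- A communication network with at most n vertices.  Every vertex v addresses
-- its incident edges through ports 0, …, deg v - 1, numbered arbitrarily and
-- independently of the other vertices; c is the constant in the O(log n)
-- bound on the length of the identifiers.
record Network (c n : ℕ) : Set where
  field
    graph : Multigraph
  open Multigraph graph public
  field
    order≤n        : order ≤ n
    deg            : Vertex → ℕ
    edge           : ∀ v → Fin (deg v) → Edge
    neighbor       : ∀ v → Fin (deg v) → Vertex
    edge-joins     : ∀ v p → Joins (edge v p) v (neighbor v p)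
    edge-injective : ∀ v → Injective _≡_ _≡_ (edge v)
    port           : ∀ {e u w} → Joins e u w → Fin (deg u)
    edge-port      : ∀ {e u w} (j : Joins e u w) → edge u (port j) ≡ e
    id             : Vertex → ID
    id-injective   : Injective _≡_ _≡_ id
    id-length      : ∀ v → length (id v) ≤ c ℕ.* log n

-- The index d is the degree of the vertex.  Initially a vertex knows its
-- identifier and the label (e.g. the palette) of the edge at each port.
record Algorithm (Label : Set) (Output : ℕ → Set) : Set₁ where
  field
    rounds  : ℕ
    State   : ℕ → Set
    Message : Set
    init    : ∀ d → ID → (Fin d → Label) → State d
    send    : ∀ d → State d → Fin d → Message
    receive : ∀ d → State d → (Fin d → Message) → State d
    output  : ∀ d → State d → Output d

module _ {c n : ℕ} {Label : Set} {Output : ℕ → Set}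
         (A : Algorithm Label Output)
         (N : Network c n) (label : Network.Edge N → Label) where
  open Network N
  open Algorithm A

  stateAfter : ℕ → (v : Vertex) → State (deg v)
  stateAfter zero    v = init (deg v) (id v) (λ p → label (edge v p))
  stateAfter (suc r) v = receive (deg v) (stateAfter r v) λ p →
    send (deg (neighbor v p)) (stateAfter r (neighbor v p))
         (port (swap (edge-joins v p)))

  run : (v : Vertex) → Output (deg v)
  run v = output (deg v) (stateAfter rounds v)

-- A vertex reports the color of the edge at each of its ports.  Local
-- computations are total functions, also defined on states that occur in no
-- admissible network, and the set of colors may be empty (when G must be
-- edgeless); hence Maybe.
ReportsColoring : ∀ {c n} (N : Network c n) {A : Set} → let open Network N in
  (∀ v → Fin (deg v) → Maybe A) → (Edge → A) → Set
ReportsColoring N out φ = ∀ v p → out v p ≡ just (φ (edge v p))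
  where open Network N

-- A vertex reports, for each of its ports, whether the edge is outgoing.
ReportsOrientation : ∀ {c n} (N : Network c n) → let open Network N in
  (∀ v → Fin (deg v) → Bool) → Orientation graph → Set
ReportsOrientation N out o =
  ∀ v p → (out v p ≡ true) ⇔ (Orientation.tail o (edge v p) ≡ v)
  where open Network N

module Submission where

-- Within any vertex set a pseudo-forest has at most as many edges as vertices:
-- a vertex of degree 3 in a graph of minimum degree 2 starts a lasso and then a
-- second one by another edge, and their cycles are distinct but connected.  Hence R spans at most a |R| edges, and
-- fewer than |R| / (1 + ε/2) vertices of R have more than t neighbors in R.
-- Repeatedly removing the other vertices exhausts the graph in O(log n / ε)
-- rounds; the round of removal is the class of a vertex.  Orient every edge
-- towards the larger pair (class, identifier).  When the at most t edges leaving
-- a vertex get distinct colors from their palettes, each color class is acyclic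
-- with outdegree at most 1, hence a forest.  With the palette {1, …, t} these
-- are rooted forests; 3-color the vertices of each and add to the color of an
-- edge the color of its tail.  No two consecutive edges then agree, so the
-- classes are star-forests.  A 3-coloring in O(log* n) rounds is not needed:
-- one Cole–Vishkin step leaves O(log n) colors, which are eliminated one by one.

open import Defs
open import Data.Bool as Bool using (Bool; true; false; _∧_; if_then_else_)
import Data.Bool.Properties as Bool
open import Data.Empty using (⊥-elim)
open import Data.Fin as Fin using (Fin; zero; suc; toℕ; combine)
import Data.Fin.Properties as Fin
import Data.Integer as ℤ
import Data.Integer.Properties as ℤ
open import Data.List as List using (List; []; _∷_; _∷ʳ_; _++_; length; filter; allFin; tabulate; lookup; fromMaybe)
import Data.List.Membership.DecPropositional as DecMembership
open import Data.List.Membership.Propositional using (_∈_; _∉_)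
open import Data.List.Membership.Propositional.Properties using (∈-filter⁺; ∈-filter⁻; ∈-allFin; ∈-lookup)
import Data.List.Membership.Setoid.Properties as Membershipₛ
open import Data.List.Properties using (length-tabulate; length-filter)
import Data.List.Relation.Binary.Lex.Strict as Lex
open import Data.List.Relation.Binary.Permutation.Propositional using (_↭_; ↭-refl; ↭-trans; prep; ↭⇒↭ₛ)
open import Data.List.Relation.Binary.Permutation.Propositional.Properties using (∷↭∷ʳ; ∈-resp-↭)
import Data.List.Relation.Binary.Permutation.Setoid.Properties as Permutationₛ
open import Data.List.Relation.Binary.Pointwise using (Pointwise-≡⇒≡)
open import Data.List.Relation.Unary.All as All using ([]; _∷_)
import Data.List.Relation.Unary.All.Properties as All
open import Data.List.Relation.Unary.AllPairs using ([]; _∷_)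
open import Data.List.Relation.Unary.Any using (here; there; index)
open import Data.List.Relation.Unary.Unique.Propositional using (Unique)
open import Data.List.Relation.Unary.Unique.Propositional.Properties using (allFin⁺; filter⁺)
open import Data.Maybe as Maybe using (Maybe; just; nothing; maybe; _<∣>_)
open import Data.Maybe.Properties as Maybe using (just-injective)
open import Data.Nat
open import Data.Nat.DivMod using (_mod_; _/_; _%_; m<n⇒m%n≡m; m%n<n; m≡m%n+[m/n]*n; m/n*n≤m)
open import Data.Nat.Induction using (<-rec)
open import Data.Nat.Logarithm using (⌈log₂_⌉; ⌈log₂⌉-mono-≤; ⌈log₂⌈n/2⌉⌉≡⌈log₂n⌉∸1)
open import Data.Nat.Properties
open import Data.Nat.Tactic.RingSolver using (solve-∀)
open import Data.Product using (Σ; ∃; ∃-syntax; _×_; _,_; proj₁; proj₂)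
open import Data.Product.Relation.Binary.Lex.Strict using (×-strictTotalOrder)
open import Data.Rational as ℚ using (ℚ; 0ℚ; 1ℚ)
import Data.Rational.Properties as ℚ
open import Data.Rational.Unnormalised as ℚᵘ using (mkℚᵘ; *≡*; *≤*)
import Data.Rational.Unnormalised.Properties as ℚᵘ
open import Data.Sum using (_⊎_; inj₁; inj₂; swap; [_,_]′)
open import Data.Unit using (⊤; tt)
open import Function using (_∘_)
open import Function.Bundles using (mk⇔; Equivalence; _⇔_)
open import Function.Definitions using (Injective)
open import Level using (0ℓ)
open import Relation.Binary.Bundles using (StrictTotalOrder)
open import Relation.Binary.Construct.Closure.Transitive using (TransClosure) renaming ([_] to ⟨_⟩; _∷_ to _◅_)
open import Relation.Binary.Definitions using (DecidableEquality; tri<; tri≈; tri>)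
open import Relation.Binary.PropositionalEquality hiding ([_])
open import Relation.Nullary
open import Relation.Nullary.Decidable using (_×-dec_; dec-true)
open import Relation.Unary using (Decidable)

open import Algebra.Properties.Semiring.Sum +-*-semiring using (sum; ∑-comm; ∑-distrib-+; sum-cong-≗; *-distribˡ-sum)

-- Every algorithm collects the full view of each vertex and applies a function to it. Since a view
-- stores the views of the vertex and of its neighbors one round earlier, the history of the peeling
-- is a recursion on the view, correctness concerns pure functions, and the number of rounds is the
-- depth that they inspect. The real `ε` is a cut, on which comparisons cannot be decided, so the
-- number of peeling rounds is computed from the integer δ = t + 1 - 2a alone. Rounding down to `t`
-- does no harm: a surviving vertex has at least t + 1 alive neighbors, and t + 1 exceeds (2 + ε) a,
-- whence δ ≥ 1 however small ε a is. Indegrees are unbounded, so an edge is colored by its tail,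
-- where at most `t` edges compete, and the head is told one round later.

-- Counting in finite sets

lookup-injective : ∀ {A : Set} {xs : List A} → Unique xs → Injective _≡_ _≡_ (lookup xs)
lookup-injective (x∉ ∷ u) {zero}  {zero}  _  = refl
lookup-injective (x∉ ∷ u) {zero}  {suc j} eq = ⊥-elim (All.lookup x∉ (∈-lookup j) eq)
lookup-injective (x∉ ∷ u) {suc i} {zero}  eq = ⊥-elim (All.lookup x∉ (∈-lookup i) (sym eq))
lookup-injective (x∉ ∷ u) {suc i} {suc j} eq = cong suc (lookup-injective u eq)

length-≤ : ∀ {A B : Set} {xs : List A} {ys : List B} → Unique xs →
           (f : ∀ {x} → x ∈ xs → ∃ λ y → y ∈ ys) →
           (∀ {x x′} (m : x ∈ xs) (m′ : x′ ∈ xs) → proj₁ (f m) ≡ proj₁ (f m′) → x ≡ x′) →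
           length xs ≤ length ys
length-≤ {xs = xs} u f inj = Fin.injective⇒≤ {f = λ i → index (proj₂ (f (∈-lookup i)))} λ {i} {j} eq →
  lookup-injective u (inj (∈-lookup i) (∈-lookup j)
    (Membershipₛ.index-injective (setoid _) (proj₂ (f (∈-lookup i))) (proj₂ (f (∈-lookup j))) eq))

unique⊆⇒length≤ : ∀ {A : Set} {xs ys : List A} → Unique xs → (∀ {x} → x ∈ xs → x ∈ ys) → length xs ≤ length ys
unique⊆⇒length≤ u sub = length-≤ u (λ m → _ , sub m) λ _ _ eq → eq

module _ {m m′ : ℕ} {P : Fin m → Set} {Q : Fin m′ → Set} (P? : Decidable P) (Q? : Decidable Q) where

  -- The image may depend on the proof of `P i`: an edge turns into a port only through a proof of
  -- incidence.
  #-injection : (f : ∀ i → P i → Fin m′) → (∀ i p → Q (f i p)) →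
                (∀ i j p q → f i p ≡ f j q → i ≡ j) → # P? ≤ # Q?
  #-injection f img inj = length-≤ (filter⁺ P? (allFin⁺ m))
    (λ {i} i∈ → f i (holds i∈) , ∈-filter⁺ Q? (∈-allFin _) (img i (holds i∈)))
    λ i∈ j∈ → inj _ _ (holds i∈) (holds j∈)
    where
    holds : ∀ {i} → i ∈ filter P? (allFin m) → P i
    holds i∈ = proj₂ (∈-filter⁻ P? {xs = allFin m} i∈)

#-mono : ∀ {m} {P Q : Fin m → Set} (P? : Decidable P) (Q? : Decidable Q) → (∀ {i} → P i → Q i) → # P? ≤ # Q?
#-mono P? Q? sub = #-injection P? Q? (λ i _ → i) (λ i → sub) (λ _ _ _ _ eq → eq)

𝟙 : ∀ {P : Set} → Dec P → ℕ
𝟙 (yes _) = 1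
𝟙 (no  _) = 0

𝟙-yes : ∀ {P : Set} (d : Dec P) → P → 𝟙 d ≡ 1
𝟙-yes (yes _) p = refl
𝟙-yes (no ¬p) p = ⊥-elim (¬p p)

#≡sum : ∀ {m} {P : Fin m → Set} (P? : Decidable P) → # P? ≡ sum (λ i → 𝟙 (P? i))
#≡sum P? = go P? (λ i → i)
  where
  go : ∀ {m k} {P : Fin m → Set} (P? : Decidable P) (f : Fin k → Fin m) →
       length (filter P? (tabulate f)) ≡ sum (λ i → 𝟙 (P? (f i)))
  go {k = zero}  P? f = refl
  go {k = suc k} P? f with P? (f zero)
  ... | yes _ = cong suc (go P? (f ∘ suc))
  ... | no  _ = go P? (f ∘ suc)

sum-mono-≤ : ∀ {m} {f g : Fin m → ℕ} → (∀ i → f i ≤ g i) → sum f ≤ sum g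
sum-mono-≤ {zero}  f≤g = z≤n
sum-mono-≤ {suc m} f≤g = +-mono-≤ (f≤g zero) (sum-mono-≤ (f≤g ∘ suc))

sum-const : ∀ m k → sum {m} (λ _ → k) ≡ m * k
sum-const zero    k = refl
sum-const (suc m) k = cong (k +_) (sum-const m k)

double-counting : ∀ {m n} {P : Fin m → Fin n → Set} (P? : ∀ i → Decidable (P i)) →
                  sum (λ i → # (P? i)) ≡ sum (λ j → # (λ i → P? i j))
double-counting P? = begin
  sum (λ i → # (P? i))                 ≡⟨ sum-cong-≗ (λ i → #≡sum (P? i)) ⟩
  sum (λ i → sum (λ j → 𝟙 (P? i j)))   ≡⟨ ∑-comm (λ i j → 𝟙 (P? i j)) ⟩
  sum (λ j → sum (λ i → 𝟙 (P? i j)))   ≡⟨ sum-cong-≗ (λ j → #≡sum (λ i → P? i j)) ⟨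
  sum (λ j → # (λ i → P? i j))         ∎
  where open ≡-Reasoning

module _ {m} {P Q S : Fin m → Set} (P? : Decidable P) (Q? : Decidable Q) (S? : Decidable S) where

  #-∪ : (∀ {i} → P i → Q i ⊎ S i) → # P? ≤ # Q? + # S?
  #-∪ cover = begin
    # P?                                           ≡⟨ #≡sum P? ⟩
    sum (λ i → 𝟙 (P? i))                           ≤⟨ sum-mono-≤ pointwise ⟩
    sum (λ i → 𝟙 (Q? i) + 𝟙 (S? i))                ≡⟨ ∑-distrib-+ (λ i → 𝟙 (Q? i)) (λ i → 𝟙 (S? i)) ⟩
    sum (λ i → 𝟙 (Q? i)) + sum (λ i → 𝟙 (S? i))    ≡⟨ cong₂ _+_ (#≡sum Q?) (#≡sum S?) ⟨
    # Q? + # S?                                    ∎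
    where
    open ≤-Reasoning
    pointwise : ∀ i → 𝟙 (P? i) ≤ 𝟙 (Q? i) + 𝟙 (S? i)
    pointwise i with P? i
    ... | no  _ = z≤n
    ... | yes p with cover p
    ...   | inj₁ q = ≤-trans (≤-reflexive (sym (𝟙-yes (Q? i) q))) (m≤m+n _ _)
    ...   | inj₂ s = ≤-trans (≤-reflexive (sym (𝟙-yes (S? i) s))) (m≤n+m _ _)

  #-⊎ : (∀ {i} → Q i → P i) → (∀ {i} → S i → P i) → (∀ {i} → Q i → ¬ S i) → # Q? + # S? ≤ # P?
  #-⊎ Q⊆P S⊆P disj = begin
    # Q? + # S?                                    ≡⟨ cong₂ _+_ (#≡sum Q?) (#≡sum S?) ⟩
    sum (λ i → 𝟙 (Q? i)) + sum (λ i → 𝟙 (S? i))    ≡⟨ ∑-distrib-+ (λ i → 𝟙 (Q? i)) (λ i → 𝟙 (S? i)) ⟨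
    sum (λ i → 𝟙 (Q? i) + 𝟙 (S? i))                ≤⟨ sum-mono-≤ pointwise ⟩
    sum (λ i → 𝟙 (P? i))                           ≡⟨ #≡sum P? ⟨
    # P?                                           ∎
    where
    open ≤-Reasoning
    pointwise : ∀ i → 𝟙 (Q? i) + 𝟙 (S? i) ≤ 𝟙 (P? i)
    pointwise i with Q? i | S? i
    ... | yes q | yes s = ⊥-elim (disj q s)
    ... | yes q | no  _ = ≤-reflexive (sym (𝟙-yes (P? i) (Q⊆P q)))
    ... | no  _ | yes s = ≤-reflexive (sym (𝟙-yes (P? i) (S⊆P s)))
    ... | no  _ | no  _ = z≤n

module _ {m} {P : Fin m → Set} (P? : Decidable P) where

  private
    holds : ∀ {i xs} → filter P? (allFin m) ≡ xs → i ∈ xs → P i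
    holds eq i∈ = proj₂ (∈-filter⁻ P? {xs = allFin m} (subst (_ ∈_) (sym eq) i∈))

    unique : ∀ {xs} → filter P? (allFin m) ≡ xs → Unique xs
    unique eq = subst Unique eq (filter⁺ P? (allFin⁺ m))

  1≤#⁺ : ∀ {i} → P i → 1 ≤ # P?
  1≤#⁺ {i} p with filter P? (allFin m) | ∈-filter⁺ P? (∈-allFin i) p
  ... | _ ∷ _ | _ = s≤s z≤n

  1≤#⁻ : 1 ≤ # P? → ∃ P
  1≤#⁻ h with filter P? (allFin m) in eq
  ... | i ∷ _ = i , holds eq (here refl)

  2≤#⁺ : ∀ {i j} → P i → P j → i ≢ j → 2 ≤ # P?
  2≤#⁺ {i} {j} pᵢ pⱼ i≢j = unique⊆⇒length≤ {xs = i ∷ j ∷ []} ((i≢j ∷ []) ∷ [] ∷ [])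
    λ { (here refl) → ∈-filter⁺ P? (∈-allFin i) pᵢ
      ; (there (here refl)) → ∈-filter⁺ P? (∈-allFin j) pⱼ }

  2≤#⁻ : 2 ≤ # P? → ∀ i → ∃[ j ] (P j × j ≢ i)
  2≤#⁻ h i with filter P? (allFin m) in eq
  ... | j ∷ k ∷ _ with unique eq | j Fin.≟ i
  ...   | (j≢k ∷ _) ∷ _ | yes refl = k , holds eq (there (here refl)) , j≢k ∘ sym
  ...   | _             | no  j≢i  = j , holds eq (here refl) , j≢i
  2≤#⁻ (s≤s ()) i | _ ∷ []

  3≤#⁻ : 3 ≤ # P? → ∃[ i ] ∃[ j ] ∃[ k ] (P i × P j × P k × i ≢ j × i ≢ k × j ≢ k)
  3≤#⁻ h with filter P? (allFin m) in eq
  ... | i ∷ j ∷ k ∷ _ with unique eq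
  ...   | (i≢j ∷ i≢k ∷ _) ∷ (j≢k ∷ _) ∷ _ = i , j , k , holds eq (here refl) , holds eq (there (here refl))
                                           , holds eq (there (there (here refl))) , i≢j , i≢k , j≢k
  3≤#⁻ (s≤s ()) | _ ∷ []
  3≤#⁻ (s≤s (s≤s ())) | _ ∷ _ ∷ []

  #≤2 : ∀ {x y} → (∀ {i} → P i → i ≡ x ⊎ i ≡ y) → # P? ≤ 2
  #≤2 {x} {y} cover = unique⊆⇒length≤ {ys = x ∷ y ∷ []} (filter⁺ P? (allFin⁺ m)) λ i∈ →
    [ here , there ∘ here ]′ (cover (proj₂ (∈-filter⁻ P? {xs = allFin m} i∈)))

-- Walks, cycles and the size of pseudo-forests

Unique-resp-↭ : ∀ {A : Set} {xs ys : List A} → xs ↭ ys → Unique xs → Unique ys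
Unique-resp-↭ p = Permutationₛ.Unique-resp-↭ (setoid _) (↭⇒↭ₛ p)

unique-∷ : ∀ {A : Set} {x : A} {xs} → x ∉ xs → Unique xs → Unique (x ∷ xs)
unique-∷ x∉xs u = All.¬Any⇒All¬ _ x∉xs ∷ u

unique-head : ∀ {A : Set} {x : A} {xs} → Unique (x ∷ xs) → x ∉ xs
unique-head (x∉ ∷ _) = All.All¬⇒¬Any x∉

module Walks (G : Multigraph) where
  open Multigraph G

  joins-incidentˡ : ∀ {e u w} → Joins e u w → Incident u e
  joins-incidentˡ (inj₁ eq) = inj₁ (sym (cong proj₁ eq))
  joins-incidentˡ (inj₂ eq) = inj₂ (sym (cong proj₂ eq))

  joins-incidentʳ : ∀ {e u w} → Joins e u w → Incident w e
  joins-incidentʳ j = joins-incidentˡ (swap j)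

  incident-joins : ∀ {e u} → Incident u e → ∃[ w ] Joins e u w
  incident-joins (inj₁ refl) = _ , inj₁ refl
  incident-joins (inj₂ refl) = _ , inj₂ refl

  incident-cases : ∀ {e u w x} → Joins e u w → Incident x e → x ≡ u ⊎ x ≡ w
  incident-cases (inj₁ eq) (inj₁ x) = inj₁ (trans x (cong proj₁ eq))
  incident-cases (inj₁ eq) (inj₂ x) = inj₂ (trans x (cong proj₂ eq))
  incident-cases (inj₂ eq) (inj₁ x) = inj₂ (trans x (cong proj₁ eq))
  incident-cases (inj₂ eq) (inj₂ x) = inj₁ (trans x (cong proj₂ eq))

  joins-functional : ∀ {e u w w′} → Joins e u w → Joins e u w′ → w ≡ w′
  joins-functional (inj₁ p) (inj₁ q) = cong proj₂ (trans (sym p) q)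
  joins-functional (inj₁ p) (inj₂ q) with refl ← trans (sym p) q = refl
  joins-functional (inj₂ p) (inj₁ q) with refl ← trans (sym p) q = refl
  joins-functional (inj₂ p) (inj₂ q) = cong proj₁ (trans (sym p) q)

  joins-≢ : ∀ {e u w} → Joins e u w → u ≢ w
  joins-≢ {e} (inj₁ eq) refl = loopless e (trans (cong proj₁ eq) (sym (cong proj₂ eq)))
  joins-≢ {e} (inj₂ eq) refl = loopless e (trans (cong proj₁ eq) (sym (cong proj₂ eq)))

  module _ {F : EdgeSet G} where

    trace : ∀ {u v} → Walk G F u v → List Vertex
    trace (stop {u})             = u ∷ []
    trace (step {u = u} _ _ _ p) = u ∷ trace p

    start∈trace : ∀ {u v} (p : Walk G F u v) → u ∈ trace p
    start∈trace stop           = here refl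
    start∈trace (step _ _ _ _) = here refl

    incident∈trace : ∀ {u v e x} (p : Walk G F u v) → e ∈ edges G p → Incident x e → x ∈ trace p
    incident∈trace (step e r j p) (here refl) i with incident-cases j i
    ... | inj₁ refl = here refl
    ... | inj₂ refl = there (start∈trace p)
    incident∈trace (step e r j p) (there m) i = there (incident∈trace p m i)

    snoc : ∀ {u v w} → Walk G F u v → ∀ e → F e → Joins e v w → Walk G F u w
    snoc stop            e r j = step e r j stop
    snoc (step f s k p)  e r j = step f s k (snoc p e r j)

    trace-snoc : ∀ {u v w} (p : Walk G F u v) e r (j : Joins e v w) → trace (snoc p e r j) ≡ trace p ∷ʳ w
    trace-snoc stop           e r j = refl
    trace-snoc (step f s k p) e r j = cong (_ ∷_) (trace-snoc p e r j)

    edges-snoc : ∀ {u v w} (p : Walk G F u v) e r (j : Joins e v w) → edges G (snoc p e r j) ≡ edges G p ∷ʳ e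
    edges-snoc stop           e r j = refl
    edges-snoc (step f s k p) e r j = cong (_ ∷_) (edges-snoc p e r j)

    reverse : ∀ {u v} → Walk G F u v → Walk G F v u
    reverse stop           = stop
    reverse (step e r j p) = snoc (reverse p) e r (swap j)

    trace-reverse : ∀ {u v} (p : Walk G F u v) → trace p ↭ trace (reverse p)
    trace-reverse stop = ↭-refl
    trace-reverse (step {u = u} e r j p) rewrite trace-snoc (reverse p) e r (swap j) =
      ↭-trans (prep _ (trace-reverse p)) (∷↭∷ʳ u (trace (reverse p)))

    edges-reverse : ∀ {u v} (p : Walk G F u v) → edges G p ↭ edges G (reverse p)
    edges-reverse stop = ↭-refl
    edges-reverse (step e r j p) rewrite edges-snoc (reverse p) e r (swap j) =
      ↭-trans (prep _ (edges-reverse p)) (∷↭∷ʳ e (edges G (reverse p)))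

    record IsPath {u v} (p : Walk G F u v) : Set where
      constructor isPath
      field
        trace-unique : Unique (trace p)
        edges-unique : Unique (edges G p)
    open IsPath public

    reverse-isPath : ∀ {u v} (p : Walk G F u v) → IsPath p → IsPath (reverse p)
    reverse-isPath p π = isPath (Unique-resp-↭ (trace-reverse p) (trace-unique π))
                                (Unique-resp-↭ (edges-reverse p) (edges-unique π))

    prefix : ∀ {u v y} (p : Walk G F u v) → IsPath p → y ∈ trace p →
             Σ (Walk G F u y) λ q → Unique (vertices G q) × y ∉ vertices G q × Unique (edges G q)
               × (∀ {x} → x ∈ vertices G q → x ∈ trace p) × (∀ {e} → e ∈ edges G q → e ∈ edges G p)
    prefix stop _ (here refl) = stop , [] , (λ ()) , [] , (λ ()) , (λ ())
    prefix (step _ _ _ _) _ (here refl) = stop , [] , (λ ()) , [] , (λ ()) , (λ ())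
    prefix (step e r j p) (isPath (u∉ ∷ tu) (e∉ ∷ eu)) (there y∈)
      with q , vu , y∉ , qu , v⊆ , e⊆ ← prefix p (isPath tu eu) y∈ =
        step e r j q
      , unique-∷ (All.All¬⇒¬Any u∉ ∘ v⊆) vu
      , (λ { (here refl) → All.All¬⇒¬Any u∉ y∈ ; (there m) → y∉ m })
      , unique-∷ (All.All¬⇒¬Any e∉ ∘ e⊆) qu
      , (λ { (here refl) → here refl ; (there m) → there (v⊆ m) })
      , (λ { (here refl) → here refl ; (there m) → there (e⊆ m) })

    -- A path never returns to its start, so only its first edge is incident to it.
    path-start-edge : ∀ {u v e f} (p : Walk G F u v) → IsPath p →
                      e ∈ edges G p → f ∈ edges G p → Incident u e → Incident u f → e ≡ f
    path-start-edge (step e r j p) π (here refl) (here refl) _ _ = refl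
    path-start-edge (step e r j p) π (there m) _ i _ = ⊥-elim (unique-head (trace-unique π) (incident∈trace p m i))
    path-start-edge (step e r j p) π _ (there m) _ i = ⊥-elim (unique-head (trace-unique π) (incident∈trace p m i))

    -- That `f` is not on the path excludes going back and forth along one edge, while a parallel
    -- edge still closes a cycle of length two.
    closing-cycle : ∀ {u v y f} (p : Walk G F u v) → IsPath p → F f → Joins f y u → y ∈ trace p → f ∉ edges G p →
                    Σ (Walk G F y y) λ c → IsCycle G c × f ∈ edges G c × (∀ {e} → e ∈ edges G c → e ∈ f ∷ edges G p)
    closing-cycle {f = f} p π Ff j y∈ f∉ with q , vu , y∉ , qu , v⊆ , e⊆ ← prefix p π y∈ =
        step f Ff j q
      , ((λ ()) , unique-∷ y∉ vu , unique-∷ (f∉ ∘ e⊆) qu)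
      , here refl
      , λ { (here refl) → here refl ; (there m) → there (e⊆ m) }

  mapWalk : ∀ {E F : EdgeSet G} → (∀ {e} → E e → F e) → ∀ {u v} → Walk G E u v → Walk G F u v
  mapWalk E⊆F stop           = stop
  mapWalk E⊆F (step e r j p) = step e (E⊆F r) j (mapWalk E⊆F p)

  edges-mapWalk : ∀ {E F : EdgeSet G} (E⊆F : ∀ {e} → E e → F e) {u v} (p : Walk G E u v) →
                  edges G (mapWalk E⊆F p) ≡ edges G p
  edges-mapWalk E⊆F stop           = refl
  edges-mapWalk E⊆F (step e r j p) = cong (e ∷_) (edges-mapWalk E⊆F p)

  vertices-mapWalk : ∀ {E F : EdgeSet G} (E⊆F : ∀ {e} → E e → F e) {u v} (p : Walk G E u v) →
                     vertices G (mapWalk E⊆F p) ≡ vertices G p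
  vertices-mapWalk E⊆F stop           = refl
  vertices-mapWalk E⊆F (step e r j p) = cong (_ ∷_) (vertices-mapWalk E⊆F p)

  isCycle-mapWalk : ∀ {E F : EdgeSet G} (E⊆F : ∀ {e} → E e → F e) {u} (p : Walk G E u u) →
                    IsCycle G p → IsCycle G (mapWalk E⊆F p)
  isCycle-mapWalk E⊆F p c rewrite edges-mapWalk E⊆F p | vertices-mapWalk E⊆F p = c

  isPseudoForest-⊆ : ∀ {E F : EdgeSet G} → (∀ {e} → E e → F e) → IsPseudoForest G F → IsPseudoForest G E
  isPseudoForest-⊆ E⊆F pf p q cp cq w e =
    subst₂ (λ xs ys → e ∈ xs ⇔ e ∈ ys) (edges-mapWalk E⊆F p) (edges-mapWalk E⊆F q)
      (pf (mapWalk E⊆F p) (mapWalk E⊆F q) (isCycle-mapWalk E⊆F p cp) (isCycle-mapWalk E⊆F q cq) (mapWalk E⊆F w) e)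

  module _ {F : EdgeSet G}
           (branch : ∀ {w f} → F f → Incident w f → ∃[ g ] (F g × g ≢ f × Incident w g)) where

    -- The path is stored from its moving end `tip` back to `v`, so that prolonging it is a single
    -- `step`. `L` holds the edges that the chord has to avoid: for the second lasso these are the
    -- edges of the first, which makes its cycle a new one.
    record Lasso (v : Vertex) (L : List Edge) : Set where
      field
        {tip knot} : Vertex
        path       : Walk G F tip v
        path-isPath : IsPath path
        chord      : Edge
        chord∈F    : F chord
        joins      : Joins chord knot tip
        knot∈path  : knot ∈ trace path
        chord∉path : chord ∉ edges G path
        chord∉L    : chord ∉ L

    -- A path whose last vertex carries an unused edge is prolonged until it
    -- returns to itself.  All of L lives on the path, so the edges at a new
    -- vertex, apart from the one just used to reach it, are outside L.
    lasso : ∀ k {u v} (p : Walk G F u v) → IsPath p → order < k + length (trace p) →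
            (L : List Edge) → (∀ {e} → e ∈ edges G p → e ∈ L) →
            (∀ {e x} → e ∈ L → Incident x e → x ∈ trace p) →
            ∀ {f} → F f → Incident u f → f ∉ L → Lasso v L
    -- `k` is fuel; once it is spent, the path would have more than `order` distinct vertices.
    lasso zero p π long L _ _ _ _ _ = ⊥-elim (<⇒≱ long
      (subst (length (trace p) ≤_) (length-allFin order)
        (unique⊆⇒length≤ (trace-unique π) λ _ → ∈-allFin _)))
      where
      length-allFin : ∀ n → length (allFin n) ≡ n
      length-allFin n = length-tabulate _
    lasso (suc k) {u} p π long L p⊆L L⊆p {f} Ff i f∉L
      with y , j ← incident-joins i with DecMembership._∈?_ Fin._≟_ y (trace p)
    ... | yes y∈ = record
      { path = p ; path-isPath = π ; chord∈F = Ff ; joins = swap j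
      ; knot∈path = y∈ ; chord∉path = f∉L ∘ p⊆L ; chord∉L = f∉L }
    ... | no y∉ with g , Fg , g≢f , ig ← branch Ff (joins-incidentʳ j) = record
      { path = Lasso.path l ; path-isPath = Lasso.path-isPath l ; chord∈F = Lasso.chord∈F l ; joins = Lasso.joins l
      ; knot∈path = Lasso.knot∈path l ; chord∉path = Lasso.chord∉path l ; chord∉L = Lasso.chord∉L l ∘ there }
      where
      p′ = step f Ff (swap j) p
      l = lasso k p′
            (isPath (unique-∷ y∉ (trace-unique π)) (unique-∷ (f∉L ∘ p⊆L) (edges-unique π)))
            (subst (order <_) (sym (+-suc k _)) long)
            (f ∷ L)
            (λ { (here refl) → here refl ; (there m) → there (p⊆L m) })
            (λ { (here refl) ix → [ (λ { refl → there (start∈trace p) }) , (λ { refl → here refl }) ]′ (incident-cases j ix)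
               ; (there m) ix → there (L⊆p m ix) })
            Fg ig
            (λ { (here eq) → g≢f eq ; (there m) → y∉ (L⊆p m ig) })

    -- The second lasso does not start afresh: it prolongs at `v` the reversed path of the first, so
    -- a return to any vertex of the first lasso closes it too. Its chord lies outside `L`, whereas
    -- the first cycle lies inside.
    two-cycles : ∀ {v f₁ f₂ f₃} → F f₁ → F f₂ → F f₃ → Incident v f₁ → Incident v f₂ → Incident v f₃ →
                 f₁ ≢ f₂ → f₁ ≢ f₃ → f₂ ≢ f₃ → ¬ IsPseudoForest G F
    two-cycles {v} {f₁} {f₂} {f₃} F₁ F₂ F₃ i₁ i₂ i₃ f₁≢f₂ f₁≢f₃ f₂≢f₃ pf =
      chord∉L l₂ (first⊆L (Equivalence.from (pf c₁ c₂ cyc₁ cyc₂ connection (chord l₂)) chord∈c₂))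
      where
      open Lasso
      l₁ : Lasso v []
      l₁ = lasso order stop (isPath ([] ∷ []) []) (≤-reflexive (+-comm 1 order)) [] (λ ()) (λ ()) F₁ i₁ (λ ())

      p : Walk G F v (tip l₁)
      p = reverse (path l₁)

      π : IsPath p
      π = reverse-isPath (path l₁) (path-isPath l₁)

      L : List Edge
      L = chord l₁ ∷ edges G p

      -- `L` has at most two edges at `v`: the first edge of `p` and the chord. Hence one of three
      -- edges is free.
      free : ∃[ f ] (F f × Incident v f × f ∉ L)
      free with DecMembership._∈?_ Fin._≟_ f₁ L | DecMembership._∈?_ Fin._≟_ f₂ L | DecMembership._∈?_ Fin._≟_ f₃ L
      ... | no ∉₁ | _ | _ = _ , F₁ , i₁ , ∉₁
      ... | _ | no ∉₂ | _ = _ , F₂ , i₂ , ∉₂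
      ... | _ | _ | no ∉₃ = _ , F₃ , i₃ , ∉₃
      ... | yes (there m₁) | yes (there m₂) | _ = ⊥-elim (f₁≢f₂ (path-start-edge p π m₁ m₂ i₁ i₂))
      ... | yes (there m₁) | _ | yes (there m₃) = ⊥-elim (f₁≢f₃ (path-start-edge p π m₁ m₃ i₁ i₃))
      ... | _ | yes (there m₂) | yes (there m₃) = ⊥-elim (f₂≢f₃ (path-start-edge p π m₂ m₃ i₂ i₃))
      ... | yes (here eq₁) | yes (here eq₂) | _ = ⊥-elim (f₁≢f₂ (trans eq₁ (sym eq₂)))
      ... | yes (here eq₁) | _ | yes (here eq₃) = ⊥-elim (f₁≢f₃ (trans eq₁ (sym eq₃)))
      ... | _ | yes (here eq₂) | yes (here eq₃) = ⊥-elim (f₂≢f₃ (trans eq₂ (sym eq₃)))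

      tip∈p : tip l₁ ∈ trace p
      tip∈p = ∈-resp-↭ (trace-reverse (path l₁)) (start∈trace (path l₁))

      L⊆p : ∀ {e x} → e ∈ L → Incident x e → x ∈ trace p
      L⊆p (there m) i = incident∈trace p m i
      L⊆p (here refl) i with incident-cases (joins l₁) i
      ... | inj₁ refl = ∈-resp-↭ (trace-reverse (path l₁)) (knot∈path l₁)
      ... | inj₂ refl = tip∈p

      l₂ : Lasso (tip l₁) L
      l₂ = lasso (suc order) p π (m≤m+n (suc order) _) L there L⊆p
             (proj₁ (proj₂ free)) (proj₁ (proj₂ (proj₂ free))) (proj₂ (proj₂ (proj₂ free)))

      cycle₁ = closing-cycle (path l₁) (path-isPath l₁) (chord∈F l₁) (joins l₁) (knot∈path l₁) (chord∉path l₁)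
      cycle₂ = closing-cycle (path l₂) (path-isPath l₂) (chord∈F l₂) (joins l₂) (knot∈path l₂) (chord∉path l₂)
      c₁ = proj₁ cycle₁
      c₂ = proj₁ cycle₂
      cyc₁ = proj₁ (proj₂ cycle₁)
      cyc₂ = proj₁ (proj₂ cycle₂)
      chord∈c₂ = proj₁ (proj₂ (proj₂ cycle₂))

      first⊆L : ∀ {e} → e ∈ edges G c₁ → e ∈ L
      first⊆L m with proj₂ (proj₂ (proj₂ cycle₁)) m
      ... | here refl = here refl
      ... | there m′  = there (∈-resp-↭ (edges-reverse (path l₁)) m′)

      connection : Walk G F (knot l₁) (knot l₂)
      connection = step (chord l₁) (chord∈F l₁) (joins l₁)
                     (reverse (step (chord l₂) (chord∈F l₂) (joins l₂) (path l₂)))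

  EdgeWithin : (Vertex → Set) → EdgeSet G → EdgeSet G
  EdgeWithin R F e = F e × R (proj₁ (ends e)) × R (proj₂ (ends e))

  edgeWithin? : ∀ {R F} → Decidable R → Decidable F → Decidable (EdgeWithin R F)
  edgeWithin? R? F? e = F? e ×-dec R? (proj₁ (ends e)) ×-dec R? (proj₂ (ends e))

  edgeWithin-incident : ∀ {R F v e} → EdgeWithin R F e → Incident v e → R v
  edgeWithin-incident (_ , r , _) (inj₁ refl) = r
  edgeWithin-incident (_ , _ , r) (inj₂ refl) = r

  degree : ∀ {E : EdgeSet G} → Decidable E → Vertex → ℕ
  degree E? v = # (λ e → E? e ×-dec incident? v e)

  handshake-≤ : ∀ {E : EdgeSet G} (E? : Decidable E) → sum (degree E?) ≤ 2 * # E?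
  handshake-≤ {E} E? = begin
    sum (degree E?)                                          ≡⟨ double-counting (λ v e → E? e ×-dec incident? v e) ⟩
    sum (λ e → # (λ v → E? e ×-dec incident? v e))           ≤⟨ sum-mono-≤ ends≤2 ⟩
    sum (λ e → 2 * 𝟙 (E? e))                                 ≡⟨ *-distribˡ-sum 2 (λ e → 𝟙 (E? e)) ⟨
    2 * sum (λ e → 𝟙 (E? e))                                 ≡⟨ cong (2 *_) (#≡sum E?) ⟨
    2 * # E?                                                 ∎
    where
    open ≤-Reasoning
    ends≤2 : ∀ e → # (λ v → E? e ×-dec incident? v e) ≤ 2 * 𝟙 (E? e)
    ends≤2 e with E? e
    ... | yes r = #≤2 (λ v → yes r ×-dec incident? v e) proj₂
    ... | no ¬r = ≮⇒≥ λ 1≤ → ¬r (proj₁ (proj₂ (1≤#⁻ (λ v → no ¬r ×-dec incident? v e) 1≤)))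

  -- Looplessness enters here: the two ends of an edge are different vertices, so the edge is
  -- counted twice.
  handshake-≥ : ∀ {E : EdgeSet G} (E? : Decidable E) → 2 * # E? ≤ sum (degree E?)
  handshake-≥ {E} E? = begin
    2 * # E?                                                 ≡⟨ cong (2 *_) (#≡sum E?) ⟩
    2 * sum (λ e → 𝟙 (E? e))                                 ≡⟨ *-distribˡ-sum 2 (λ e → 𝟙 (E? e)) ⟩
    sum (λ e → 2 * 𝟙 (E? e))                                 ≤⟨ sum-mono-≤ 2≤ends ⟩
    sum (λ e → # (λ v → E? e ×-dec incident? v e))           ≡⟨ double-counting (λ v e → E? e ×-dec incident? v e) ⟨
    sum (degree E?)                                          ∎
    where
    open ≤-Reasoning
    2≤ends : ∀ e → 2 * 𝟙 (E? e) ≤ # (λ v → E? e ×-dec incident? v e)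
    2≤ends e with E? e
    ... | yes r = 2≤#⁺ (λ v → yes r ×-dec incident? v e) (r , inj₁ refl) (r , inj₂ refl) (loopless e)
    ... | no _  = z≤n

  -- Induction on the size of `R`. Deleting a vertex of degree at most 1 loses at most one edge. If
  -- there is none, `two-cycles` excludes degree 3, so all degrees in `R` are 2 and the handshake
  -- lemma concludes.
  pseudoForest-size : ∀ {R F} (R? : Decidable R) (F? : Decidable F) → IsPseudoForest G F →
                      # (edgeWithin? R? F?) ≤ # R?
  pseudoForest-size {F = F} R? F? pf = go _ R? ≤-refl
    where
    go : ∀ k {R : Vertex → Set} (R? : Decidable R) → # R? ≤ k → # (edgeWithin? R? F?) ≤ # R?
    go k {R} R? R≤k with Fin.any? (λ v → R? v ×-dec degree (edgeWithin? R? F?) v ≤? 1)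
    go zero    R? R≤k | yes (v , r , _) = ⊥-elim (<⇒≱ (1≤#⁺ R? r) R≤k)
    go (suc k) {R} R? R≤k | yes (v , r , d≤1) = begin
      # (edgeWithin? R? F?)                                   ≤⟨ #-∪ _ (edgeWithin? R-v? F?) (λ e → edgeWithin? R? F? e ×-dec incident? v e) split ⟩
      # (edgeWithin? R-v? F?) + degree (edgeWithin? R? F?) v  ≤⟨ +-mono-≤ (go k R-v? (s≤s⁻¹ (≤-trans smaller R≤k))) d≤1 ⟩
      # R-v? + 1                                              ≡⟨ +-comm _ 1 ⟩
      suc (# R-v?)                                            ≤⟨ smaller ⟩
      # R?                                                    ∎
      where
      open ≤-Reasoning
      R-v? : Decidable (λ u → R u × u ≢ v)
      R-v? u = R? u ×-dec ¬? (u Fin.≟ v)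

      smaller : suc (# R-v?) ≤ # R?
      smaller = ≤-trans (+-monoˡ-≤ _ (1≤#⁺ (Fin._≟ v) refl))
                  (#-⊎ R? (Fin._≟ v) R-v? (λ { refl → r }) proj₁ (λ eq r′ → proj₂ r′ eq))

      split : ∀ {e} → EdgeWithin R F e → EdgeWithin (λ u → R u × u ≢ v) F e ⊎ (EdgeWithin R F e × Incident v e)
      split {e} w@(f , r₁ , r₂) with incident? v e
      ... | yes i = inj₂ (w , i)
      ... | no ¬i = inj₁ (f , (r₁ , ¬i ∘ inj₁ ∘ sym) , (r₂ , ¬i ∘ inj₂ ∘ sym))
    go k {R} R? R≤k | no dense with Fin.any? (λ v → 3 ≤? degree (edgeWithin? R? F?) v)
    ... | yes (v , 3≤d) with f₁ , f₂ , f₃ , (w₁ , i₁) , (w₂ , i₂) , (w₃ , i₃) , f₁≢f₂ , f₁≢f₃ , f₂≢f₃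
                               ← 3≤#⁻ (λ e → edgeWithin? R? F? e ×-dec incident? v e) 3≤d =
      ⊥-elim (two-cycles branch w₁ w₂ w₃ i₁ i₂ i₃ f₁≢f₂ f₁≢f₃ f₂≢f₃ (isPseudoForest-⊆ proj₁ pf))
      where
      branch : ∀ {w f} → EdgeWithin R F f → Incident w f → ∃[ g ] (EdgeWithin R F g × g ≢ f × Incident w g)
      branch {w} {f} wf i with g , (wg , ig) , g≢f ← 2≤#⁻ (λ e → edgeWithin? R? F? e ×-dec incident? w e)
                                 (≰⇒> λ d≤1 → dense (w , edgeWithin-incident {R} {F} wf i , d≤1)) f = g , wg , g≢f , ig
    ... | no sparse = *-cancelˡ-≤ 2 (begin
      2 * # (edgeWithin? R? F?)            ≤⟨ handshake-≥ (edgeWithin? R? F?) ⟩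
      sum (degree (edgeWithin? R? F?))     ≤⟨ sum-mono-≤ degree≤2 ⟩
      sum (λ v → 2 * 𝟙 (R? v))             ≡⟨ *-distribˡ-sum 2 (λ v → 𝟙 (R? v)) ⟨
      2 * sum (λ v → 𝟙 (R? v))             ≡⟨ cong (2 *_) (#≡sum R?) ⟨
      2 * # R?                             ∎)
      where
      open ≤-Reasoning
      degree≤2 : ∀ v → degree (edgeWithin? R? F?) v ≤ 2 * 𝟙 (R? v)
      degree≤2 v with R? v
      ... | yes _ = ≮⇒≥ λ 3≤ → sparse (v , 3≤)
      ... | no ¬r = ≮⇒≥ λ 1≤ →
        let e , (w , i) = 1≤#⁻ (λ e → edgeWithin? R? F? e ×-dec incident? v e) 1≤
        in ¬r (edgeWithin-incident {R} {F} w i)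

  pseudoForestPartition-size : ∀ {k} → HasPseudoForestPartition G k → ∀ {R} (R? : Decidable R) →
                               # (λ e → R? (proj₁ (ends e)) ×-dec R? (proj₂ (ends e))) ≤ k * # R?
  pseudoForestPartition-size {k} (φ , pf) {R} R? = begin
    # within?                                          ≡⟨ #≡sum within? ⟩
    sum (λ e → 𝟙 (within? e))                          ≤⟨ sum-mono-≤ pointwise ⟩
    sum (λ e → # (λ c → φ e Fin.≟ c ×-dec within? e))  ≡⟨ double-counting (λ c e → φ e Fin.≟ c ×-dec within? e) ⟨
    sum (λ c → # (λ e → φ e Fin.≟ c ×-dec within? e))  ≤⟨ sum-mono-≤ (λ c → pseudoForest-size R? (λ e → φ e Fin.≟ c) (pf c)) ⟩
    sum {k} (λ _ → # R?)                               ≡⟨ sum-const k _ ⟩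
    k * # R?                                           ∎
    where
    open ≤-Reasoning
    within? : Decidable (λ e → R (proj₁ (ends e)) × R (proj₂ (ends e)))
    within? e = R? (proj₁ (ends e)) ×-dec R? (proj₂ (ends e))

    pointwise : ∀ e → 𝟙 (within? e) ≤ # (λ c → φ e Fin.≟ c ×-dec within? e)
    pointwise e with within? e
    ... | yes w = 1≤#⁺ (λ c → φ e Fin.≟ c ×-dec yes w) (refl , w)
    ... | no _  = z≤n

-- Logarithms and geometric decay

n≤2^⌈log₂n⌉ : ∀ n → n ≤ 2 ^ ⌈log₂ n ⌉
n≤2^⌈log₂n⌉ = <-rec _ go
  where
  go : ∀ n → (∀ {m} → m < n → m ≤ 2 ^ ⌈log₂ m ⌉) → n ≤ 2 ^ ⌈log₂ n ⌉
  go 0 _ = z≤n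
  go 1 _ = s≤s z≤n
  go n@(suc (suc m)) rec = begin
    n                               ≡⟨ ⌊n/2⌋+⌈n/2⌉≡n n ⟨
    ⌊ n /2⌋ + ⌈ n /2⌉               ≤⟨ +-monoˡ-≤ ⌈ n /2⌉ (⌊n/2⌋≤⌈n/2⌉ n) ⟩
    ⌈ n /2⌉ + ⌈ n /2⌉               ≡⟨ cong (⌈ n /2⌉ +_) (+-identityʳ _) ⟨
    2 * ⌈ n /2⌉                     ≤⟨ *-monoʳ-≤ 2 (rec (⌈n/2⌉<n m)) ⟩
    2 ^ suc ⌈log₂ ⌈ n /2⌉ ⌉         ≡⟨ cong (λ l → 2 ^ suc l) (⌈log₂⌈n/2⌉⌉≡⌈log₂n⌉∸1 n) ⟩
    2 ^ suc (⌈log₂ n ⌉ ∸ 1)         ≡⟨ cong (2 ^_) (m+[n∸m]≡n (⌈log₂⌉-mono-≤ {2} {n} (s≤s (s≤s z≤n)))) ⟩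
    2 ^ ⌈log₂ n ⌉                   ∎
    where open ≤-Reasoning

n≤2^log : ∀ n → n ≤ 2 ^ log n
n≤2^log n = ≤-trans (m≤n⊔m 2 n) (n≤2^⌈log₂n⌉ (2 ⊔ n))

1≤log : ∀ n → 1 ≤ log n
1≤log n = ⌈log₂⌉-mono-≤ {2} {2 ⊔ n} (m≤m⊔n 2 n)

-- A quantity that shrinks by the factor b / (b + δ) per step halves every s
-- steps as soon as s δ > b, since (1 + δ / b)ˢ ≥ 1 + s δ / b (Bernoulli).
module Decay (x : ℕ → ℕ) (x-dec : ∀ i → x (suc i) ≤ x i) {b δ : ℕ} (s : ℕ)
             (shrink : ∀ i → (b + δ) * x (suc i) ≤ b * x i) (b<sδ : b < s * δ) where
  open ≤-Reasoning

  -- Stating the inequality for `x` itself avoids powers of (b + δ) / b: one factor is used up by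
  -- `shrink`, and the remaining multiple of δ only needs that `x` does not increase.
  bernoulli : ∀ j i → b * x (j + i) + j * δ * x (j + i) ≤ b * x i
  bernoulli zero    i = ≤-reflexive (+-identityʳ _)
  bernoulli (suc j) i = begin
    b * y′ + suc j * δ * y′         ≡⟨ regroup b δ j y′ ⟩
    (b + δ) * y′ + j * δ * y′       ≤⟨ +-mono-≤ (shrink (j + i)) (*-monoʳ-≤ (j * δ) (x-dec (j + i))) ⟩
    b * y + j * δ * y               ≤⟨ bernoulli j i ⟩
    b * x i                         ∎
    where
    y  = x (j + i)
    y′ = x (suc j + i)
    regroup : ∀ b δ j y → b * y + suc j * δ * y ≡ (b + δ) * y + j * δ * y
    regroup = solve-∀

  halve : ∀ i → 2 * x (s + i) ≤ x i
  halve i = ≮⇒≥ λ xᵢ<2y → <⇒≱ (begin-strict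
    b * x i                  ≤⟨ *-monoʳ-≤ b (<⇒≤ xᵢ<2y) ⟩
    -- Multiplying `xᵢ<2y` by `b` may lose strictness, as `b` can be 0; the spare `y` restores it.
    b * (2 * y)              <⟨ m<m+n _ (y>0 xᵢ<2y) ⟩
    b * (2 * y) + y          ≡⟨ regroup b y ⟩
    b * y + suc b * y        ≤⟨ +-monoʳ-≤ (b * y) (*-monoˡ-≤ y b<sδ) ⟩
    b * y + s * δ * y        ∎) (bernoulli s i)
    where
    y = x (s + i)
    y>0 : x i < 2 * y → 0 < y
    y>0 xᵢ<2y = *-cancelˡ-< 2 0 y (≤-<-trans z≤n xᵢ<2y)
    regroup : ∀ b y → b * (2 * y) + y ≡ b * y + suc b * y
    regroup = solve-∀

  exponential : ∀ l → 2 ^ l * x (l * s) ≤ x 0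
  exponential zero    = ≤-reflexive (+-identityʳ _)
  exponential (suc l) = begin
    2 * 2 ^ l * x (s + l * s)        ≡⟨ regroup (2 ^ l) _ ⟩
    2 ^ l * (2 * x (s + l * s))      ≤⟨ *-monoʳ-≤ (2 ^ l) (halve (l * s)) ⟩
    2 ^ l * x (l * s)                ≤⟨ exponential l ⟩
    x 0                              ∎
    where
    regroup : ∀ p y → 2 * p * y ≡ p * (2 * y)
    regroup = solve-∀

  -- After `l` halvings the bound is 1; one more brings it below 1, that is to 0.
  vanishes : ∀ l → x 0 ≤ 2 ^ l → x (suc l * s) ≡ 0
  vanishes l x₀≤ = n<1⇒n≡0 (*-cancelˡ-< (2 ^ suc l) _ 1 (begin-strict
    2 ^ suc l * x (suc l * s)   ≤⟨ exponential (suc l) ⟩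
    x 0                         ≤⟨ x₀≤ ⟩
    2 ^ l                       <⟨ ^-monoʳ-< 2 (s≤s (s≤s z≤n)) (n<1+n l) ⟩
    2 ^ suc l                   ≡⟨ *-identityʳ _ ⟨
    2 ^ suc l * 1               ∎))

-- Views and peeling

∧-does⁻ : ∀ {b} {P : Set} (P? : Dec P) → b ∧ does P? ≡ true → b ≡ true × P
∧-does⁻ {true} (yes p) _ = refl , p

∧-does⁺ : ∀ {b} {P : Set} (P? : Dec P) → b ≡ true → P → b ∧ does P? ≡ true
∧-does⁺ P? refl p = dec-true P? p

-- What a vertex of degree d can have learnt: node v m w q extends the view v
-- by the views w p of the neighbors, where the edge at port p has number q p
-- at its other end.
data View (Label : Set) : ℕ → Set where
  leaf : ∀ {d} → ID → (Fin d → Label) → View Label d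
  node : ∀ {d} → View Label d → (m : Fin d → ℕ) → (∀ p → View Label (m p)) → (∀ p → Fin (m p)) → View Label d

-- The full-information protocol. The port number travels with the view so that the receiver can
-- find the shared edge in the sender's data, even among parallel edges.
viewAlgorithm : ∀ {Label Output} → ℕ → (∀ d → View Label d → Output d) → Algorithm Label Output
viewAlgorithm {Label} r f = record
  { rounds  = r
  ; State   = View Label
  ; Message = ∃[ d ] (View Label d × Fin d)
  ; init    = λ _ → leaf
  ; send    = λ d v p → d , v , p
  ; receive = λ _ v μ → node v (λ p → proj₁ (μ p)) (λ p → proj₁ (proj₂ (μ p))) (λ p → proj₂ (proj₂ (μ p)))
  ; output  = f
  }

module Local {Label : Set} where

  ident : ∀ {d} → View Label d → ID
  ident (leaf i _)     = i
  ident (node v _ _ _) = ident v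

  labels : ∀ {d} → View Label d → Fin d → Label
  labels (leaf _ l)     = l
  labels (node v _ _ _) = labels v

  module _ (t : ℕ) where

    -- Removing the outer `node` goes back one round for the vertex, and `w` holds its neighbors at
    -- that same earlier time. Counting ports instead of vertices counts neighbors with
    -- multiplicity.
    alive : ∀ {d} → View Label d → Bool
    alive (leaf _ _)     = true
    alive (node v _ w _) = alive v ∧ does (suc t ≤? # (λ p → alive (w p) Bool.≟ true))

    -- The number of rounds survived. It stays frozen after the removal, so deeper views do not
    -- change the class.
    level : ∀ {d} → View Label d → ℕ
    level (leaf _ _)         = 0
    level u@(node v _ _ _)   = if alive u then suc (level v) else level v

open Local public

module NetworkProperties {c n : ℕ} (N : Network c n) where
  open Network N
  open Walks graph public

  tail-port : ∀ {e u w} (j : Joins e u w) p → edge u p ≡ e → p ≡ port j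
  tail-port j p eq = edge-injective _ (trans eq (sym (edge-port j)))

  neighbor-unique : ∀ {e u w} → Joins e u w → ∀ p → edge u p ≡ e → neighbor u p ≡ w
  neighbor-unique j p refl = joins-functional (edge-joins _ p) j

module Views {c n : ℕ} {Label : Set} {Output : ℕ → Set} (r : ℕ) (f : ∀ d → View Label d → Output d)
             (N : Network c n) (label : Network.Edge N → Label) where
  open Network N
  open NetworkProperties N public

  view : ℕ → ∀ v → View Label (deg v)
  view = stateAfter (viewAlgorithm r f) N label

  ident-view : ∀ i v → ident (view i v) ≡ id v
  ident-view zero    v = refl
  ident-view (suc i) v = ident-view i v

  labels-view : ∀ i v p → labels (view i v) p ≡ label (edge v p)
  labels-view zero    v p = refl
  labels-view (suc i) v p = labels-view i v p

  module _ (t : ℕ) where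

    Alive : ℕ → Vertex → Set
    Alive i v = alive t (view i v) ≡ true

    alive? : ∀ i → Decidable (Alive i)
    alive? i v = alive t (view i v) Bool.≟ true

    aliveNeighbors : ℕ → Vertex → ℕ
    aliveNeighbors i v = # (λ p → alive? i (neighbor v p))

    alive-suc⁻ : ∀ i v → Alive (suc i) v → Alive i v × t < aliveNeighbors i v
    alive-suc⁻ i v = ∧-does⁻ (suc t ≤? aliveNeighbors i v)

    dead-suc⁻ : ∀ i v → Alive i v → ¬ Alive (suc i) v → aliveNeighbors i v ≤ t
    dead-suc⁻ i v al dead = ≮⇒≥ (dead ∘ ∧-does⁺ (suc t ≤? aliveNeighbors i v) al)

    alive-antitone : ∀ {i j v} → i ≤′ j → Alive j v → Alive i v
    alive-antitone ≤′-refl al = al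
    alive-antitone {j = suc j} {v} (≤′-step i≤j) al = alive-antitone i≤j (proj₁ (alive-suc⁻ j v al))

    lev : ℕ → Vertex → ℕ
    lev i v = level t (view i v)

    level-alive : ∀ i {v} → Alive i v → lev i v ≡ i
    level-alive zero    al = refl
    level-alive (suc i) {v} al rewrite al = cong suc (level-alive i (proj₁ (alive-suc⁻ i v al)))

    alive-≤level : ∀ i {j v} → j ≤ lev i v → Alive j v
    alive-≤level zero    z≤n = refl
    alive-≤level (suc i) {j} {v} j≤ with alive t (view (suc i) v) in eq
    ... | true  = alive-antitone (≤⇒≤′ (≤-trans j≤ (≤-reflexive (cong suc (level-alive i (proj₁ (alive-suc⁻ i v eq))))))) eq
    ... | false = alive-≤level i j≤

    -- With `alive-≤level` this identifies the level of a removed vertex as the last round in which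
    -- it is alive.
    dead-level : ∀ i {v} → ¬ Alive i v → lev i v < i × ¬ Alive (suc (lev i v)) v
    dead-level zero    dead = ⊥-elim (dead refl)
    dead-level (suc i) {v} dead with alive t (view (suc i) v) in eq
    ... | true  = ⊥-elim (dead refl)
    ... | false with alive? i v
    ...   | yes al rewrite level-alive i al = ≤-refl , λ al′ → contradiction (trans (sym eq) al′) λ ()
    ...   | no ¬al = let l<i , d = dead-level i ¬al in m≤n⇒m≤1+n l<i , d

    -- Each survivor has at least t + 1 edges inside the previous alive set, and every edge spanned
    -- by that set is counted at most twice.
    peeling-bound : ∀ {a*} → HasPseudoForestPartition graph a* →
                    ∀ i → suc t * # (alive? (suc i)) ≤ 2 * (a* * # (alive? i))
    peeling-bound {a*} partition i = begin
      suc t * # (alive? (suc i))                     ≡⟨ cong (suc t *_) (#≡sum (alive? (suc i))) ⟩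
      suc t * sum (λ v → 𝟙 (alive? (suc i) v))       ≡⟨ *-distribˡ-sum (suc t) (λ v → 𝟙 (alive? (suc i) v)) ⟩
      sum (λ v → suc t * 𝟙 (alive? (suc i) v))       ≤⟨ sum-mono-≤ pointwise ⟩
      sum (degree E?)                                ≤⟨ handshake-≤ E? ⟩
      2 * # E?                                       ≤⟨ *-monoʳ-≤ 2 (pseudoForestPartition-size partition (alive? i)) ⟩
      2 * (a* * # (alive? i))                        ∎
      where
      open ≤-Reasoning
      E? : Decidable (λ e → Alive i (proj₁ (ends e)) × Alive i (proj₂ (ends e)))
      E? e = alive? i (proj₁ (ends e)) ×-dec alive? i (proj₂ (ends e))

      bothAlive : ∀ {e u w} → Joins e u w → Alive i u → Alive i w → Alive i (proj₁ (ends e)) × Alive i (proj₂ (ends e))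
      bothAlive (inj₁ eq) al al′ = subst (Alive i) (sym (cong proj₁ eq)) al  , subst (Alive i) (sym (cong proj₂ eq)) al′
      bothAlive (inj₂ eq) al al′ = subst (Alive i) (sym (cong proj₁ eq)) al′ , subst (Alive i) (sym (cong proj₂ eq)) al

      pointwise : ∀ v → suc t * 𝟙 (alive? (suc i) v) ≤ degree E? v
      pointwise v with alive? (suc i) v
      ... | no  _  = ≤-trans (≤-reflexive (*-zeroʳ (suc t))) z≤n
      ... | yes al with al′ , t< ← alive-suc⁻ i v al = begin
        suc t * 1             ≡⟨ *-identityʳ (suc t) ⟩
        suc t                 ≤⟨ t< ⟩
        aliveNeighbors i v    ≤⟨ #-injection (λ p → alive? i (neighbor v p)) (λ e → E? e ×-dec incident? v e)
                                   (λ p _ → edge v p)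
                                   (λ p alₚ → bothAlive (edge-joins v p) al′ alₚ , joins-incidentˡ (edge-joins v p))
                                   (λ _ _ _ _ → edge-injective v) ⟩
        degree E? v           ∎

    peeled : ∀ {a a* δ} s → HasPseudoForestPartition graph a* → a* ≤ a → 2 * a + δ ≡ suc t → 2 * a < s * δ →
             ∀ v → ¬ Alive (suc (log n) * s) v
    peeled {a} {a*} {δ} s partition a*≤a δ-def s-large v al =
      n≮0 (subst (1 ≤_) (vanishes (log n) alive₀) (1≤#⁺ (alive? (suc (log n) * s)) al))
      where
      shrink : ∀ i → (2 * a + δ) * # (alive? (suc i)) ≤ 2 * a * # (alive? i)
      shrink i rewrite δ-def = begin
        suc t * # (alive? (suc i))   ≤⟨ peeling-bound partition i ⟩
        2 * (a* * # (alive? i))      ≤⟨ *-monoʳ-≤ 2 (*-monoˡ-≤ _ a*≤a) ⟩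
        2 * (a * # (alive? i))       ≡⟨ *-assoc 2 a _ ⟨
        2 * a * # (alive? i)         ∎
        where open ≤-Reasoning
      decrease : ∀ i → # (alive? (suc i)) ≤ # (alive? i)
      decrease i = #-mono (alive? (suc i)) (alive? i) λ {v} al → proj₁ (alive-suc⁻ i v al)
      open Decay (λ i → # (alive? i)) decrease s shrink s-large
      alive₀ : # (alive? 0) ≤ 2 ^ log n
      alive₀ = begin
        # (alive? 0)                 ≤⟨ length-filter (alive? 0) (allFin order) ⟩
        length (allFin order)        ≡⟨ length-tabulate {n = order} (λ v → v) ⟩
        order                        ≤⟨ order≤n ⟩
        n                            ≤⟨ n≤2^log n ⟩
        2 ^ log n                    ∎
        where open ≤-Reasoning

    module _ {i} (peeled-i : ∀ v → ¬ Alive i v) where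

      laterEdge? : ∀ v → Decidable (λ e → Incident v e × lev i v ≤ lev i (proj₁ (ends e)) × lev i v ≤ lev i (proj₂ (ends e)))
      laterEdge? v e = incident? v e ×-dec (lev i v ≤? lev i (proj₁ (ends e))) ×-dec (lev i v ≤? lev i (proj₂ (ends e)))

      -- Just after round `lev i v` the vertex is removed, so it then has at most `t` alive
      -- neighbors. A neighbor of at least the same level is alive in that round and is among those
      -- counted.
      laterEdges≤t : ∀ v → # (laterEdge? v) ≤ t
      laterEdges≤t v = ≤-trans
        (#-injection (laterEdge? v) (λ p → alive? l (neighbor v p))
          (λ e later → port (proj₂ (incident-joins (proj₁ later))))
          (λ e later → neighborAlive (proj₁ later) (proj₂ later))
          λ e e′ later later′ eq → trans (sym (edge-port (proj₂ (incident-joins (proj₁ later)))))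
                                     (trans (cong (edge v) eq) (edge-port (proj₂ (incident-joins (proj₁ later′))))))
        (dead-suc⁻ l v (alive-≤level i ≤-refl) (proj₂ (dead-level i (peeled-i v))))
        where
        l = lev i v
        neighborAlive : ∀ {e} (inc : Incident v e) → l ≤ lev i (proj₁ (ends e)) × l ≤ lev i (proj₂ (ends e)) →
                        Alive l (neighbor v (port (proj₂ (incident-joins inc))))
        neighborAlive {e} inc (l≤₁ , l≤₂) with w , j ← incident-joins inc
          rewrite neighbor-unique j (port j) (edge-port j) with joins-incidentʳ j
        ... | inj₁ refl = alive-≤level i l≤₁
        ... | inj₂ refl = alive-≤level i l≤₂

-- Ordering the vertices and choosing colors greedily

keyOrder : StrictTotalOrder 0ℓ 0ℓ 0ℓ
keyOrder = ×-strictTotalOrder <-strictTotalOrder (Lex.<-strictTotalOrder Bool.<-strictTotalOrder)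

module Key = StrictTotalOrder keyOrder

_≺_ : ℕ × ID → ℕ × ID → Set
_≺_ = Key._<_

_≺?_ : ∀ k l → Dec (k ≺ l)
_≺?_ = Key._<?_

≺⇒≤ : ∀ {k l} → k ≺ l → proj₁ k ≤ proj₁ l
≺⇒≤ (inj₁ lt)       = <⇒≤ lt
≺⇒≤ (inj₂ (eq , _)) = ≤-reflexive eq

module Choose {A : Set} (_≟_ : DecidableEquality A) where
  open DecMembership _≟_ using (_∈?_)

  pick : List A → List A → Maybe A
  pick used xs = List.head (filter (λ x → ¬? (x ∈? used)) xs)

  pick-sound : ∀ {used xs x} → pick used xs ≡ just x → x ∈ xs × x ∉ used
  pick-sound {used} {xs} eq with filter (λ x → ¬? (x ∈? used)) xs in f-eq
  pick-sound {used} {xs} refl | _ ∷ _ =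
    ∈-filter⁻ (λ x → ¬? (x ∈? used)) (subst (_ ∈_) (sym f-eq) (here refl))

  pick-total : ∀ {used xs} → Unique xs → length used < length xs → ∃[ x ] pick used xs ≡ just x
  pick-total {used} {xs} u lt with filter (λ x → ¬? (x ∈? used)) xs in f-eq
  ... | x ∷ _ = x , refl
  ... | []    = ⊥-elim (<⇒≱ lt (unique⊆⇒length≤ u all-used))
    where
    all-used : ∀ {x} → x ∈ xs → x ∈ used
    all-used {x} x∈ with x ∈? used
    ... | yes x∈used = x∈used
    ... | no  x∉used with () ← subst (x ∈_) f-eq (∈-filter⁺ (λ x → ¬? (x ∈? used)) x∈ x∉used)

  -- Greedy in the order of the ports: the color of each outgoing port joins `used` for the later
  -- ones, and other ports consume no color.
  choose : ∀ {d} → List A → (Fin d → Bool) → (Fin d → List A) → Fin d → Maybe A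
  choose used out Q zero    = if out zero then pick used (Q zero) else nothing
  choose used out Q (suc p) = choose (fromMaybe (choose used out Q zero) ++ used) (out ∘ suc) (Q ∘ suc) p

  choose-sound : ∀ {d} used (out : Fin d → Bool) Q p {x} →
                 choose used out Q p ≡ just x → out p ≡ true × x ∈ Q p × x ∉ used
  choose-sound used out Q zero eq with true ← out zero = refl , pick-sound eq
  choose-sound used out Q (suc p) eq with choose used out Q zero
  ... | nothing = choose-sound used (out ∘ suc) (Q ∘ suc) p eq
  ... | just y  with o , x∈ , x∉ ← choose-sound (y ∷ used) (out ∘ suc) (Q ∘ suc) p eq = o , x∈ , x∉ ∘ there

  choose-injective : ∀ {d} used (out : Fin d → Bool) Q p q {x} →
                     choose used out Q p ≡ just x → choose used out Q q ≡ just x → p ≡ q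
  choose-injective used out Q zero zero _ _ = refl
  choose-injective used out Q (suc p) (suc q) eq eq′ = cong suc (choose-injective _ (out ∘ suc) (Q ∘ suc) p q eq eq′)
  choose-injective used out Q zero (suc q) eq eq′ with just y ← choose used out Q zero =
    ⊥-elim (proj₂ (proj₂ (choose-sound _ (out ∘ suc) (Q ∘ suc) q eq′)) (here (sym (just-injective eq))))
  choose-injective used out Q (suc p) zero eq eq′ with just y ← choose used out Q zero =
    ⊥-elim (proj₂ (proj₂ (choose-sound _ (out ∘ suc) (Q ∘ suc) p eq)) (here (sym (just-injective eq′))))

  -- Invariant: the colors used and the outgoing ports still to come number at most `t`. An outgoing
  -- port itself is one of the latter, so it finds fewer than `t` colors used.
  choose-total : ∀ {d t} used (out : Fin d → Bool) Q → (∀ p → Unique (Q p) × length (Q p) ≡ t) →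
                 length used + sum (λ p → 𝟙 (out p Bool.≟ true)) ≤ t →
                 ∀ p → out p ≡ true → ∃[ x ] choose used out Q p ≡ just x
  choose-total {t = t} used out Q palette room zero o with out zero
  choose-total {t = t} used out Q palette room zero refl | true =
    pick-total (proj₁ (palette zero)) (begin-strict
      length used                ≤⟨ m≤m+n _ _ ⟩
      length used + _            <⟨ +-monoʳ-< (length used) (n<1+n _) ⟩
      length used + suc _        ≤⟨ room ⟩
      t                          ≡⟨ proj₂ (palette zero) ⟨
      length (Q zero)            ∎)
    where open ≤-Reasoning
  choose-total {suc d} {t} used out Q palette room (suc p) o =
    choose-total _ (out ∘ suc) (Q ∘ suc) (palette ∘ suc) room′ p o
    where
    open ≤-Reasoning
    rest = sum (λ p → 𝟙 (out (suc p) Bool.≟ true))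

    grow : length (fromMaybe (choose used out Q zero) ++ used) ≤ length used + 𝟙 (out zero Bool.≟ true)
    grow with out zero
    ... | false = ≤-reflexive (sym (+-identityʳ _))
    ... | true with pick used (Q zero)
    ...   | nothing = m≤m+n _ 1
    ...   | just _  = ≤-reflexive (+-comm 1 _)

    room′ : length (fromMaybe (choose used out Q zero) ++ used) + rest ≤ t
    room′ = begin
      length (fromMaybe (choose used out Q zero) ++ used) + rest   ≤⟨ +-monoˡ-≤ rest grow ⟩
      length used + 𝟙 (out zero Bool.≟ true) + rest                ≡⟨ +-assoc (length used) _ rest ⟩
      length used + (𝟙 (out zero Bool.≟ true) + rest)              ≤⟨ room ⟩
      t                                                            ∎

-- Forests and star-forests from monotone orientations

-- In a forest whose edges point to larger vertices with at most one edge out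
-- of each vertex, a trail cannot turn from going down to going up, so a closed
-- trail would be monotone.
module MonotoneOrientation (G : Multigraph) (o : Orientation G)
                           (_⊏_ : Multigraph.Vertex G → Multigraph.Vertex G → Set)
                           (⊏-trans : ∀ {u v w} → u ⊏ v → v ⊏ w → u ⊏ w) (⊏-irrefl : ∀ {v} → ¬ (v ⊏ v))
                           (tail⊏head : ∀ e → Orientation.tail o e ⊏ Orientation.head o e) where
  open Multigraph G
  open Orientation o
  open Walks G

  direction : ∀ {e u w} → Joins e u w → (tail e ≡ u × head e ≡ w) ⊎ (tail e ≡ w × head e ≡ u)
  direction {e} j with incident-cases j (joins-incidentˡ (joins e))
  ... | inj₁ refl = inj₁ (refl , joins-functional (joins e) j)
  ... | inj₂ refl = inj₂ (refl , joins-functional (joins e) (swap j))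

  ⊏⇒tail : ∀ {e u w} → Joins e u w → u ⊏ w → tail e ≡ u
  ⊏⇒tail {e} j u⊏w with direction j
  ... | inj₁ (t≡u , _)     = t≡u
  ... | inj₂ (refl , refl) = ⊥-elim (⊏-irrefl (⊏-trans u⊏w (tail⊏head e)))

  acyclic : Acyclic
  acyclic v c = ⊏-irrefl (closure⇒⊏ c)
    where
    closure⇒⊏ : ∀ {u w} → TransClosure Arc u w → u ⊏ w
    closure⇒⊏ ⟨ e , refl , refl ⟩       = tail⊏head e
    closure⇒⊏ ((e , refl , refl) ◅ c)   = ⊏-trans (tail⊏head e) (closure⇒⊏ c)

  module _ {F : EdgeSet G} (out-unique : ∀ {e f} → F e → F f → tail e ≡ tail f → e ≡ f) where

    -- Here `e` is the edge just walked from head to tail. As the only edge of `F` leaving `u` it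
    -- blocks every way up, so the trail keeps going down, and its last edge leaves `v`.
    descending : ∀ {e u v} (p : Walk G F u v) → F e → tail e ≡ u → Unique (e ∷ edges G p) →
                 (v ≡ u ⊎ v ⊏ u) × ∃[ f ] (f ∈ e ∷ edges G p × F f × tail f ≡ v)
    descending stop Fe te _ = inj₁ refl , _ , here refl , Fe , te
    descending (step f Ff j p) Fe te (e∉ ∷ u) with direction j
    ... | inj₁ (tf , _) = ⊥-elim (unique-head (e∉ ∷ u) (here (out-unique Fe Ff (trans te (sym tf)))))
    ... | inj₂ (refl , refl) with descending p Ff refl u
    ...   | v≤w , g , g∈ , last = inj₂ ([ (λ { refl → tail⊏head f }) , (λ v⊏w → ⊏-trans v⊏w (tail⊏head f)) ]′ v≤w)
                                , g , there g∈ , last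

    ascending : ∀ {u v} (p : Walk G F u v) → Unique (edges G p) →
                (u ≡ v ⊎ u ⊏ v) ⊎ ∃[ f ] (f ∈ edges G p × F f × tail f ≡ v)
    ascending stop _ = inj₁ (inj₁ refl)
    ascending (step f Ff j p) (f∉ ∷ u) with direction j
    ... | inj₂ (tf , _) = inj₂ (proj₂ (descending p Ff tf (f∉ ∷ u)))
    ... | inj₁ (refl , refl) with ascending p u
    ...   | inj₁ (inj₁ refl) = inj₁ (inj₂ (tail⊏head f))
    ...   | inj₁ (inj₂ w⊏v)  = inj₁ (inj₂ (⊏-trans (tail⊏head f) w⊏v))
    ...   | inj₂ (g , g∈ , last) = inj₂ (g , there g∈ , last)

    isForest : IsForest G F
    isForest stop (nonempty , _) = nonempty refl
    isForest (step f Ff j p) (_ , _ , f∉ ∷ u) with direction j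
    ... | inj₂ (refl , refl) = contra (proj₁ (descending p Ff refl (f∉ ∷ u)))
      where
      contra : ¬ (head f ≡ tail f ⊎ head f ⊏ tail f)
      contra (inj₁ eq) = ⊏-irrefl (subst (tail f ⊏_) eq (tail⊏head f))
      contra (inj₂ lt) = ⊏-irrefl (⊏-trans lt (tail⊏head f))
    ... | inj₁ (refl , refl) with ascending p u
    ...   | inj₁ (inj₁ eq) = ⊏-irrefl (subst (tail f ⊏_) eq (tail⊏head f))
    ...   | inj₁ (inj₂ lt) = ⊏-irrefl (⊏-trans lt (tail⊏head f))
    -- The walk leaves its base upwards by `f` and returns downwards by `g`; both have the base as
    -- tail, so `f` would be repeated.
    ...   | inj₂ (g , g∈ , Fg , tg) = unique-head (f∉ ∷ u) (subst (_∈ edges G p) (out-unique Fg Ff tg) g∈)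

    module _ (F? : Decidable F) (no-path : ∀ {e f} → F e → F f → head e ≢ tail f) where

      -- By `no-path` a head has no outgoing edge in `F` and is its own center; so both ends of an
      -- edge share the center, which is thus constant on components.
      center : Vertex → Vertex
      center v with Fin.any? (λ e → F? e ×-dec tail e Fin.≟ v)
      ... | yes (e , _) = head e
      ... | no _        = v

      center-tail : ∀ {e v} → F e → tail e ≡ v → center v ≡ head e
      center-tail {e} {v} Fe te with Fin.any? (λ e → F? e ×-dec tail e Fin.≟ v)
      ... | yes (f , Ff , tf) = cong head (out-unique Ff Fe (trans tf (sym te)))
      ... | no ¬out           = ⊥-elim (¬out (e , Fe , te))

      center-head : ∀ {e v} → F e → head e ≡ v → center v ≡ head e
      center-head {e} {v} Fe he with Fin.any? (λ e → F? e ×-dec tail e Fin.≟ v)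
      ... | yes (f , Ff , tf) = ⊥-elim (no-path Fe Ff (trans he (sym tf)))
      ... | no _              = sym he

      center-incident : ∀ {e v} → F e → Incident v e → center v ≡ head e
      center-incident {e} Fe i with incident-cases (joins e) i
      ... | inj₁ v≡t = center-tail Fe (sym v≡t)
      ... | inj₂ v≡h = center-head Fe (sym v≡h)

      center-walk : ∀ {u v} → Walk G F u v → center u ≡ center v
      center-walk stop = refl
      center-walk (step e Fe j p) = trans (center-incident Fe (joins-incidentˡ j))
        (trans (sym (center-incident Fe (joins-incidentʳ j))) (center-walk p))

      to-center : ∀ v → Walk G F v (center v)
      to-center v with Fin.any? (λ e → F? e ×-dec tail e Fin.≟ v)
      ... | yes (e , Fe , refl) = step e Fe (joins e) stop
      ... | no _                = stop

      isStarForest : IsStarForest G F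
      isStarForest = isForest , λ v → center v , to-center v , λ e x Fe i p →
        subst (λ u → Incident u e) (sym (trans (center-walk p) (center-incident Fe i))) (joins-incidentʳ (joins e))

-- Colors chosen at the tails

-- Only the tail computes the color of an edge. One further round shows each end the answer of the
-- other, and `_<∣>_` selects the one that is a `just`.
module TailColoring {c n : ℕ} (N : Network c n) (o : Orientation (Network.graph N))
                    {A : Set} (g : ∀ v → Fin (Network.deg N v) → Maybe A)
                    (g-tail : ∀ v p → Orientation.tail o (Network.edge N v p) ≡ v → ∃[ x ] g v p ≡ just x)
                    (g-head : ∀ v p → Orientation.tail o (Network.edge N v p) ≢ v → g v p ≡ nothing) where
  open Network N
  open Orientation o
  open NetworkProperties N

  tailPort : ∀ e → Fin (deg (tail e))
  tailPort e = port (joins e)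

  φ : Edge → A
  φ e = proj₁ (g-tail (tail e) (tailPort e) (cong tail (edge-port (joins e))))

  φ-tail : ∀ {v p e} → edge v p ≡ e → tail e ≡ v → g v p ≡ just (φ e)
  φ-tail {p = p} {e} eq refl rewrite tail-port (joins e) p eq =
    proj₂ (g-tail (tail e) (tailPort e) (cong tail (edge-port (joins e))))

  φ-reports : ReportsColoring N (λ v p → g v p <∣> g (neighbor v p) (port (swap (edge-joins v p)))) φ
  φ-reports v p with tail (edge v p) Fin.≟ v
  ... | yes t≡v rewrite φ-tail refl t≡v = refl
  ... | no  t≢v rewrite g-head v p t≢v = φ-tail (edge-port (swap (edge-joins v p))) (sym tail≡neighbor)
    where
    tail≡neighbor : neighbor v p ≡ tail (edge v p)
    tail≡neighbor with incident-cases (edge-joins v p) (joins-incidentˡ (joins (edge v p)))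
    ... | inj₁ t≡v = ⊥-elim (t≢v t≡v)
    ... | inj₂ t≡w = sym t≡w

  module _ (g-injective : ∀ v {p q x} → g v p ≡ just x → g v q ≡ just x → p ≡ q) where

    φ-injective : ∀ {e f} → φ e ≡ φ f → tail e ≡ tail f → e ≡ f
    φ-injective {e} {f} same t≡ = trans (sym (edge-port (joins e))) (trans (cong (edge _) p≡q) (edge-port j))
      where
      j : Joins f (tail e) (head f)
      j = subst (λ u → Joins f u (head f)) (sym t≡) (joins f)
      p≡q : tailPort e ≡ port j
      p≡q = g-injective (tail e) (φ-tail (edge-port (joins e)) refl)
              (trans (φ-tail (edge-port j) (sym t≡)) (cong just (sym same)))

module LocalOrientation {Label : Set} (t : ℕ) where

  key : ∀ {d} → View Label d → ℕ × ID
  key v = level t v , ident v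

  outgoing : ∀ {d} → View Label d → Fin d → Bool
  outgoing (leaf _ _)     p = false
  outgoing (node v _ w _) p = does (key v ≺? key (w p))

  module _ {A : Set} (_≟_ : DecidableEquality A) (Q : Label → List A) where
    open Choose _≟_

    chosen : ∀ {d} → View Label d → Fin d → Maybe A
    chosen v = choose [] (outgoing v) (Q ∘ labels v)

module OrientedViews {c n : ℕ} {Label : Set} {Output : ℕ → Set} (r : ℕ) (f : ∀ d → View Label d → Output d)
                     (N : Network c n) (label : Network.Edge N → Label) (t i : ℕ)
                     (peeled-i : ∀ v → ¬ Views.Alive r f N label t i v) where
  open Network N
  open Views r f N label
  open LocalOrientation {Label} t public

  keyAt : Vertex → ℕ × ID
  keyAt v = key (view i v)

  _⊏_ : Vertex → Vertex → Set
  u ⊏ v = keyAt u ≺ keyAt v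

  ⊏-total : ∀ {u v} → u ≢ v → ¬ (u ⊏ v) → v ⊏ u
  ⊏-total {u} {v} u≢v u⊀v with Key.compare (keyAt u) (keyAt v)
  ... | tri< u≺v _ _ = ⊥-elim (u⊀v u≺v)
  ... | tri> _ _ v≺u = v≺u
  ... | tri≈ _ (_ , eq) _ = ⊥-elim (u≢v (id-injective
    (trans (sym (ident-view i u)) (trans (Pointwise-≡⇒≡ eq) (ident-view i v)))))

  arc : ∀ {u v} → Dec (u ⊏ v) → Vertex × Vertex
  arc {u} {v} (yes _) = u , v
  arc {u} {v} (no _)  = v , u

  arc-joins : ∀ {e u v} (u⊏v? : Dec (u ⊏ v)) → Joins e u v → Joins e (proj₁ (arc u⊏v?)) (proj₂ (arc u⊏v?))
  arc-joins (yes _) j = j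
  arc-joins (no _)  j = swap j

  arc-⊏ : ∀ {u v} (u⊏v? : Dec (u ⊏ v)) → u ≢ v → proj₁ (arc u⊏v?) ⊏ proj₂ (arc u⊏v?)
  arc-⊏ (yes u⊏v) _   = u⊏v
  arc-⊏ (no u⊀v)  u≢v = ⊏-total u≢v u⊀v

  arcOf : ∀ e → Dec (proj₁ (ends e) ⊏ proj₂ (ends e))
  arcOf e = keyAt (proj₁ (ends e)) ≺? keyAt (proj₂ (ends e))

  orientation : Orientation graph
  orientation = record
    { tail  = λ e → proj₁ (arc (arcOf e))
    ; head  = λ e → proj₂ (arc (arcOf e))
    ; joins = λ e → arc-joins (arcOf e) (inj₁ refl)
    }
  open Orientation orientation public

  tail⊏head : ∀ e → tail e ⊏ head e
  tail⊏head e = arc-⊏ (arcOf e) (loopless e)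

  ⊏-irrefl : ∀ {v} → ¬ (v ⊏ v)
  ⊏-irrefl {v} = Key.irrefl (Key.Eq.refl {keyAt v})

  open MonotoneOrientation graph orientation _⊏_ Key.trans ⊏-irrefl tail⊏head public

  outgoing⇔tail : ∀ v p → (outgoing (view (suc i) v) p ≡ true) ⇔ (tail (edge v p) ≡ v)
  outgoing⇔tail v p = mk⇔
    (λ out → ⊏⇒tail (edge-joins v p) (proj₂ (∧-does⁻ {true} v⊏w? out)))
    (λ t≡v → dec-true v⊏w? (v⊏w t≡v))
    where
    v⊏w? = keyAt v ≺? keyAt (neighbor v p)
    v⊏w : tail (edge v p) ≡ v → v ⊏ neighbor v p
    v⊏w t≡v with direction (edge-joins v p)
    ... | inj₁ (t≡v , h≡w) = subst₂ _⊏_ t≡v h≡w (tail⊏head (edge v p))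
    ... | inj₂ (t≡w , _) = ⊥-elim (joins-≢ (edge-joins v p) (trans (sym t≡v) t≡w))

  -- The level comes first in the lexicographic order, so no edge points to a smaller class.
  outdegree≤t : ∀ v → outdegree v ≤ t
  outdegree≤t v = ≤-trans (#-mono (λ e → tail e Fin.≟ v) (laterEdge? t {i} peeled-i v) later)
                          (laterEdges≤t t {i} peeled-i v)
    where
    later : ∀ {e} → tail e ≡ v → Incident v e × lev t i v ≤ lev t i (proj₁ (ends e)) × lev t i v ≤ lev t i (proj₂ (ends e))
    later {e} refl = joins-incidentˡ (joins e) , above (joins e)
      where
      lev≤ : lev t i (tail e) ≤ lev t i (head e)
      lev≤ = ≺⇒≤ (tail⊏head e)
      above : Joins e (tail e) (head e) →
              lev t i (tail e) ≤ lev t i (proj₁ (ends e)) × lev t i (tail e) ≤ lev t i (proj₂ (ends e))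
      above (inj₁ eq) = ≤-reflexive (cong (lev t i) (sym (cong proj₁ eq))) , ≤-trans lev≤ (≤-reflexive (cong (lev t i) (sym (cong proj₂ eq))))
      above (inj₂ eq) = ≤-trans lev≤ (≤-reflexive (cong (lev t i) (sym (cong proj₁ eq)))) , ≤-reflexive (cong (lev t i) (sym (cong proj₂ eq)))

  -- Reading the palette off the label through `Q` covers both uses: palettes given as input, and
  -- the constant palette `allFin t`.
  module Chosen {A : Set} (_≟_ : DecidableEquality A) (Q : Label → List A)
                (palettes : ∀ e → Unique (Q (label e)) × length (Q (label e)) ≡ t) where
    open Choose _≟_

    chosenAt : ∀ v → Fin (deg v) → Maybe A
    chosenAt v = chosen _≟_ Q (view (suc i) v)

    private
      outs : ∀ v → sum (λ p → 𝟙 (outgoing (view (suc i) v) p Bool.≟ true)) ≤ t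
      outs v = ≤-trans (≤-reflexive (sym (#≡sum (λ p → outgoing (view (suc i) v) p Bool.≟ true))))
        (≤-trans (#-injection (λ p → outgoing (view (suc i) v) p Bool.≟ true) (λ e → tail e Fin.≟ v)
                   (λ p _ → edge v p) (λ p → Equivalence.to (outgoing⇔tail v p)) (λ _ _ _ _ → edge-injective v))
                 (outdegree≤t v))

    chosen-tail : ∀ v p → tail (edge v p) ≡ v → ∃[ x ] chosenAt v p ≡ just x
    chosen-tail v p t≡v = choose-total [] (outgoing (view (suc i) v)) (Q ∘ labels (view (suc i) v))
      (λ p → subst (λ l → Unique (Q l) × length (Q l) ≡ t) (sym (labels-view (suc i) v p)) (palettes (edge v p)))
      (outs v) p (Equivalence.from (outgoing⇔tail v p) t≡v)

    chosen-head : ∀ v p → tail (edge v p) ≢ v → chosenAt v p ≡ nothing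
    chosen-head v p t≢v with chosenAt v p in eq
    ... | nothing = refl
    ... | just x  = ⊥-elim (t≢v (Equivalence.to (outgoing⇔tail v p)
                      (proj₁ (choose-sound [] (outgoing (view (suc i) v)) (Q ∘ labels (view (suc i) v)) p eq))))

    chosen-injective : ∀ v {p q x} → chosenAt v p ≡ just x → chosenAt v q ≡ just x → p ≡ q
    chosen-injective v {p} {q} = choose-injective [] (outgoing (view (suc i) v)) (Q ∘ labels (view (suc i) v)) p q

    open TailColoring N orientation chosenAt chosen-tail chosen-head public

    chosen-listForest : IsListForestDecomposition graph (Q ∘ label) φ
    chosen-listForest =
        (λ e → in-palette e (φ-tail (edge-port (joins e)) refl))
      , λ c → isForest λ φe φf → φ-injective chosen-injective (trans φe (sym φf))
      where
      in-palette : ∀ e {x} → chosenAt (tail e) (tailPort e) ≡ just x → x ∈ Q (label e)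
      in-palette e {x} eq = subst (λ f → x ∈ Q (label f)) (edge-port (joins e))
        (subst (λ l → x ∈ Q l) (labels-view (suc i) (tail e) (tailPort e))
          (proj₁ (proj₂ (choose-sound [] (outgoing (view (suc i) (tail e))) (Q ∘ labels (view (suc i) (tail e))) _ eq))))

-- Three-coloring rooted forests

-- One Cole–Vishkin step: the position where two identifiers first differ,
-- together with the symbol of the first one there (0 for its end).
coleVishkin : ID → ID → ℕ
coleVishkin []          _           = 0
coleVishkin (false ∷ x) (false ∷ y) = 3 + coleVishkin x y
coleVishkin (true  ∷ x) (true  ∷ y) = 3 + coleVishkin x y
coleVishkin (false ∷ x) _           = 1
coleVishkin (true  ∷ x) _           = 2

coleVishkin-< : ∀ x y → coleVishkin x y < 3 + 3 * length x
coleVishkin-< [] y = s≤s z≤n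
coleVishkin-< (false ∷ x) (false ∷ y) rewrite *-suc 3 (length x) = s≤s (s≤s (s≤s (coleVishkin-< x y)))
coleVishkin-< (true  ∷ x) (true  ∷ y) rewrite *-suc 3 (length x) = s≤s (s≤s (s≤s (coleVishkin-< x y)))
coleVishkin-< (false ∷ x) []          = s≤s (s≤s z≤n)
coleVishkin-< (false ∷ x) (true ∷ y)  = s≤s (s≤s z≤n)
coleVishkin-< (true ∷ x)  []          = s≤s (s≤s (s≤s z≤n))
coleVishkin-< (true ∷ x)  (false ∷ y) = s≤s (s≤s (s≤s z≤n))

-- The value is 3 · position + symbol. Equal values would give `x` and `y` the same symbol at the
-- position where they first differ. Nothing is asked of `z`.
coleVishkin-proper : ∀ x y z → x ≢ y → coleVishkin x y ≢ coleVishkin y z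
coleVishkin-proper []          []          z x≢y _ = x≢y refl
coleVishkin-proper []          (false ∷ y) []          _ ()
coleVishkin-proper []          (false ∷ y) (false ∷ z) _ ()
coleVishkin-proper []          (false ∷ y) (true ∷ z)  _ ()
coleVishkin-proper []          (true ∷ y)  []          _ ()
coleVishkin-proper []          (true ∷ y)  (false ∷ z) _ ()
coleVishkin-proper []          (true ∷ y)  (true ∷ z)  _ ()
coleVishkin-proper (false ∷ x) []          z           _ ()
coleVishkin-proper (true ∷ x)  []          z           _ ()
coleVishkin-proper (false ∷ x) (true ∷ y)  []          _ ()
coleVishkin-proper (false ∷ x) (true ∷ y)  (false ∷ z) _ ()
coleVishkin-proper (false ∷ x) (true ∷ y)  (true ∷ z)  _ ()
coleVishkin-proper (true ∷ x)  (false ∷ y) []          _ ()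
coleVishkin-proper (true ∷ x)  (false ∷ y) (false ∷ z) _ ()
coleVishkin-proper (true ∷ x)  (false ∷ y) (true ∷ z)  _ ()
coleVishkin-proper (false ∷ x) (false ∷ y) []          _ ()
coleVishkin-proper (false ∷ x) (false ∷ y) (true ∷ z)  _ ()
coleVishkin-proper (true ∷ x)  (true ∷ y)  []          _ ()
coleVishkin-proper (true ∷ x)  (true ∷ y)  (false ∷ z) _ ()
coleVishkin-proper (false ∷ x) (false ∷ y) (false ∷ z) x≢y eq =
  coleVishkin-proper x y z (x≢y ∘ cong (false ∷_)) (+-cancelˡ-≡ 3 _ _ eq)
coleVishkin-proper (true ∷ x)  (true ∷ y)  (true ∷ z)  x≢y eq =
  coleVishkin-proper x y z (x≢y ∘ cong (true ∷_)) (+-cancelˡ-≡ 3 _ _ eq)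

free : ℕ → ℕ → ℕ
free 0 1 = 2
free 1 0 = 2
free 0 _ = 1
free _ 0 = 1
free _ _ = 0

free<3 : ∀ a b → free a b < 3
free<3 0             0             = s≤s (s≤s z≤n)
free<3 0             1             = s≤s (s≤s (s≤s z≤n))
free<3 0             (suc (suc b)) = s≤s (s≤s z≤n)
free<3 1             0             = s≤s (s≤s (s≤s z≤n))
free<3 (suc (suc a)) 0             = s≤s (s≤s z≤n)
free<3 1             (suc b)       = s≤s z≤n
free<3 (suc (suc a)) (suc b)       = s≤s z≤n

free≢ˡ : ∀ a b → free a b ≢ a
free≢ˡ 0             0             ()
free≢ˡ 0             1             ()
free≢ˡ 0             (suc (suc b)) ()
free≢ˡ 1             0             ()
free≢ˡ 1             (suc b)       ()
free≢ˡ (suc (suc a)) 0             ()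
free≢ˡ (suc (suc a)) (suc b)       ()

free≢ʳ : ∀ a b → free a b ≢ b
free≢ʳ 0             0             ()
free≢ʳ 0             1             ()
free≢ʳ 0             (suc (suc b)) ()
free≢ʳ 1             0             ()
free≢ʳ 1             (suc b)       ()
free≢ʳ (suc (suc a)) 0             ()
free≢ʳ (suc (suc a)) (suc b)       ()

if-does : ∀ {P : Set} (P? : Dec P) {x y : ℕ} →
          (P × (if does P? then x else y) ≡ x) ⊎ (¬ P × (if does P? then x else y) ≡ y)
if-does (yes p) = inj₁ (p , refl)
if-does (no ¬p) = inj₂ (¬p , refl)

m∸n≤1+m∸1+n : ∀ m n → m ∸ n ≤ suc (m ∸ suc n)
m∸n≤1+m∸1+n zero    zero    = z≤n
m∸n≤1+m∸1+n zero    (suc n) = z≤n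
m∸n≤1+m∸1+n (suc m) zero    = ≤-refl
m∸n≤1+m∸1+n (suc m) (suc n) = m∸n≤1+m∸1+n m n

-- The algorithm must be total and cannot assume that a color is below `b`; on colors that are,
-- `mod` is the identity.
combine-mod-injective : ∀ {b t} .{{_ : NonZero b}} x y (i j : Fin t) → x < b → y < b →
                        combine (x mod b) i ≡ combine (y mod b) j → x ≡ y × i ≡ j
combine-mod-injective {b} x y i j x<b y<b eq with x≡y , i≡j ← Fin.combine-injective (x mod b) i (y mod b) j eq = (begin
  x               ≡⟨ m<n⇒m%n≡m x<b ⟨
  x % b           ≡⟨ Fin.toℕ-fromℕ< (m%n<n x b) ⟨
  toℕ (x mod b)   ≡⟨ cong toℕ x≡y ⟩
  toℕ (y mod b)   ≡⟨ Fin.toℕ-fromℕ< (m%n<n y b) ⟩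
  y % b           ≡⟨ m<n⇒m%n≡m y<b ⟩
  y               ∎) , i≡j
  where open ≡-Reasoning

portOf : ∀ {d t} → (Fin d → Maybe (Fin t)) → Fin t → Maybe (Fin d)
portOf tag j with Fin.any? (λ p → Maybe.≡-dec Fin._≟_ (tag p) (just j))
... | yes (p , _) = just p
... | no _        = nothing

portOf-sound : ∀ {d t} (tag : Fin d → Maybe (Fin t)) j {p} → portOf tag j ≡ just p → tag p ≡ just j
portOf-sound tag j eq with Fin.any? (λ p → Maybe.≡-dec Fin._≟_ (tag p) (just j))
portOf-sound tag j refl | yes (p , eq) = eq

portOf-complete : ∀ {d t} (tag : Fin d → Maybe (Fin t)) {j p} → tag p ≡ just j → ∃[ q ] portOf tag j ≡ just q
portOf-complete tag {j} {p} eq with Fin.any? (λ p → Maybe.≡-dec Fin._≟_ (tag p) (just j))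
... | yes (q , _) = q , refl
... | no none     = ⊥-elim (none (p , eq))

-- A vertex has a separate color for each of the `t` rooted forests, which are processed in
-- parallel.
record Colors (t d : ℕ) : Set where
  field
    tag             : Fin d → Maybe (Fin t)
    current shifted : Fin t → ℕ
open Colors

edgeColor : ∀ {t d} → Colors t d → Fin d → Maybe (Fin (3 * t))
edgeColor κ p = Maybe.map (λ j → combine (current κ j mod 3) j) (tag κ p)

-- Every vertex has at most one outgoing edge of each tag j.  These edges form
-- a rooted forest, in which the other end of the edge is the parent.
module LocalColoring {Label : Set} (t : ℕ) where
  open LocalOrientation {Label} t

  tags : ∀ {d} → View Label d → Fin d → Maybe (Fin t)
  tags = chosen Fin._≟_ (λ _ → allFin t)

  initial : ∀ {d} → View Label d → Colors t d
  initial (leaf _ _) = record { tag = λ _ → nothing ; current = λ _ → 0 ; shifted = λ _ → 0 }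
  initial (node v _ w _) = record
    { tag     = tags v
    -- A root compares itself with the empty identifier; any string would do, because
    -- `coleVishkin-proper` leaves its third argument arbitrary.
    ; current = λ j → coleVishkin (ident v) (maybe (λ p → ident (w p)) [] (portOf (tags v) j))
    ; shifted = λ _ → 0 }

  module _ (f : ∀ {d} → View Label d → Colors t d) where

    shift : ∀ {d} → View Label d → Colors t d
    shift u@(leaf _ _)   = f u
    shift (node v _ w _) = record (f v)
      -- A root has no parent to copy. It has to leave its old color, which its children now
      -- receive.
      { shifted = λ j → maybe (λ p → current (f (w p)) j) (free (current (f v) j) (current (f v) j)) (portOf (tag (f v)) j) }

    -- After the shift all children of v carry the previous color of v, so that
    -- only two colors are forbidden to v.
    recolor : ℕ → ∀ {d} → View Label d → Colors t d
    recolor k u@(leaf _ _)   = f u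
    recolor k (node v _ w _) = record (f v)
      { current = λ j → if does (shifted (f v) j ≟ k)
                        then free (current (f v) j) (maybe (λ p → shifted (f (w p)) j) 0 (portOf (tag (f v)) j))
                        else shifted (f v) j }

  -- As long as `k` is below `m`, `3 + (m ∸ suc k)` is the largest color possible after `k` stages.
  -- Retiring it each time leaves the colors 0, 1, 2 after `m` stages.
  colors : ℕ → ℕ → ∀ {d} → View Label d → Colors t d
  colors m zero    = initial
  colors m (suc k) = recolor (shift (colors m k)) (3 + (m ∸ suc k))

module ColoredViews {c n : ℕ} {Label : Set} {Output : ℕ → Set} (r : ℕ) (f : ∀ d → View Label d → Output d)
                    (N : Network c n) (label : Network.Edge N → Label) (t i : ℕ)
                    (peeled-i : ∀ v → ¬ Views.Alive r f N label t i v)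
                    (m : ℕ) (id-short : ∀ v → 3 * length (Network.id N v) ≤ m) where
  open Network N
  open Views r f N label
  open OrientedViews r f N label t i peeled-i
  open LocalColoring {Label} t
  open Chosen Fin._≟_ (λ _ → allFin t) (λ _ → allFin⁺ t , length-tabulate _)

  -- The levels take `i` rounds, comparing keys across edges one, reading the parent's identifier
  -- one, and every stage two: shift and recolor.
  radius : ℕ → ℕ
  radius k = k * 2 + (2 + i)

  C S : ℕ → ∀ v → Colors t (deg v)
  C k v = colors m k (view (radius k) v)
  S k v = shift (colors m k) (view (suc (radius k)) v)

  X Y : ℕ → Vertex → Fin t → ℕ
  X k v = current (C k v)
  Y k v = shifted (S k v)

  parentPort : ℕ → ∀ v → Fin t → Maybe (Fin (deg v))
  parentPort k v = portOf (tag (C k v))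

  tag-C : ∀ k v → tag (C k v) ≡ chosenAt v
  tag-C zero    v = refl
  tag-C (suc k) v = tag-C k v

  X-suc : ∀ k v j → let retired = 3 + (m ∸ suc k) in
          (Y k v j ≡ retired × X (suc k) v j ≡ free (X k v j) (maybe (λ p → Y k (neighbor v p) j) 0 (parentPort k v j)))
        ⊎ (Y k v j ≢ retired × X (suc k) v j ≡ Y k v j)
  X-suc k v j = if-does (Y k v j ≟ 3 + (m ∸ suc k))

  X-bound : ∀ k v j → X k v j < 3 + (m ∸ k)
  Y-bound : ∀ k v j → Y k v j < 3 + (m ∸ k)
  Y-bound k v j with parentPort k v j
  ... | just p  = X-bound k (neighbor v p) j
  ... | nothing = ≤-trans (free<3 (X k v j) (X k v j)) (m≤m+n 3 _)
  X-bound zero v j = ≤-trans (coleVishkin-< (ident (view (suc i) v)) _) (+-monoʳ-≤ 3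
    (subst (λ x → 3 * length x ≤ m) (sym (ident-view (suc i) v)) (id-short v)))
  X-bound (suc k) v j with X-suc k v j
  ... | inj₁ (_ , eq)  rewrite eq = ≤-trans (free<3 (X k v j) _) (m≤m+n 3 _)
  ... | inj₂ (Y≢ , eq) rewrite eq = ≤∧≢⇒< (s≤s⁻¹ (≤-trans (Y-bound k v j) (+-monoʳ-≤ 3 (m∸n≤1+m∸1+n m k)))) Y≢

  Proper : ℕ → Set
  Proper k = ∀ v j {p} → parentPort k v j ≡ just p → X k v j ≢ X k (neighbor v p) j

  Y-parent : ∀ k v j {p} → parentPort k v j ≡ just p → Y k v j ≡ X k (neighbor v p) j
  Y-parent k v j eq rewrite eq = refl

  Y≢X : ∀ k → Proper k → ∀ v j → Y k v j ≢ X k v j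
  Y≢X k proper v j with parentPort k v j in eq
  ... | just p  = proper v j eq ∘ sym
  ... | nothing = free≢ˡ (X k v j) (X k v j)

  -- Let u be the parent of v. After the shift v carries the old color of u, and u has a different
  -- one (`Y≢X`), so u and v are not both recolored. If v is, `free` avoids the new color of u; if u
  -- is, `free` avoids its own old color, which v carries.
  X-proper : ∀ k → Proper k
  X-proper zero v j {p} eq rewrite eq = coleVishkin-proper (ident (view (suc i) v)) _ _ λ same →
    joins-≢ (edge-joins v p) (id-injective (trans (sym (ident-view (suc i) v)) (trans same (ident-view (suc i) (neighbor v p)))))
  X-proper (suc k) v j {p} eq same with X-suc k v j | X-suc k (neighbor v p) j
  ... | inj₁ (Yv , _)  | inj₁ (Yu , _)  = Y≢X k (X-proper k) (neighbor v p) j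
                                            (trans Yu (trans (sym Yv) (Y-parent k v j eq)))
  ... | inj₁ (_ , Xv)  | inj₂ (_ , Xu)  rewrite eq = free≢ʳ (X k v j) _ (trans (sym Xv) (trans same Xu))
  ... | inj₂ (_ , Xv)  | inj₁ (_ , Xu)  = free≢ˡ (X k (neighbor v p) j) _
                                            (trans (sym Xu) (trans (sym same) (trans Xv (Y-parent k v j eq))))
  ... | inj₂ (_ , Xv)  | inj₂ (_ , Xu)  = Y≢X k (X-proper k) (neighbor v p) j
                                            (trans (sym Xu) (trans (sym same) (trans Xv (Y-parent k v j eq))))

  edgeColorAt : ∀ v → Fin (deg v) → Maybe (Fin (3 * t))
  edgeColorAt v = edgeColor (C m v)

  edgeColor-just : ∀ {v p j} → chosenAt v p ≡ just j → edgeColorAt v p ≡ just (combine (X m v j mod 3) j)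
  edgeColor-just {v} {p} eq rewrite tag-C m v | eq = refl

  edgeColor-nothing : ∀ {v p} → chosenAt v p ≡ nothing → edgeColorAt v p ≡ nothing
  edgeColor-nothing {v} {p} eq rewrite tag-C m v | eq = refl

  open TailColoring N orientation edgeColorAt
    (λ v p t≡v → _ , edgeColor-just (proj₂ (chosen-tail v p t≡v)))
    (λ v p t≢v → edgeColor-nothing (chosen-head v p t≢v))
    using () renaming (φ to ψ; φ-tail to ψ-tail; φ-reports to ψ-reports) public

  ψ≡combine : ∀ e → ψ e ≡ combine (X m (tail e) (φ e) mod 3) (φ e)
  ψ≡combine e = just-injective (trans (sym (ψ-tail (edge-port (joins e)) refl))
                                      (edgeColor-just (φ-tail (edge-port (joins e)) refl)))

  X<3 : ∀ v j → X m v j < 3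
  X<3 v j = subst (λ d → X m v j < 3 + d) (n∸n≡0 m) (X-bound m v j)

  ψ-injective : ∀ e f → ψ e ≡ ψ f → X m (tail e) (φ e) ≡ X m (tail f) (φ f) × φ e ≡ φ f
  ψ-injective e f same = combine-mod-injective (X m (tail e) (φ e)) (X m (tail f) (φ f)) (φ e) (φ f)
    (X<3 (tail e) (φ e)) (X<3 (tail f) (φ f)) (trans (sym (ψ≡combine e)) (trans same (ψ≡combine f)))

  -- `portOf` returns some port with the tag of `e`; tags at a vertex being distinct, it is the port
  -- of `e`, and the parent is `head e`.
  X-tail≢head : ∀ e → X m (tail e) (φ e) ≢ X m (head e) (φ e)
  X-tail≢head e = subst (λ v → X m (tail e) (φ e) ≢ X m v (φ e)) (neighbor-unique (joins e) q edge-q)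
      (X-proper m (tail e) (φ e) (trans (cong (λ τ → portOf τ (φ e)) (tag-C m (tail e))) eq))
    where
    chosen-e : chosenAt (tail e) (tailPort e) ≡ just (φ e)
    chosen-e = φ-tail (edge-port (joins e)) refl
    parent : ∃[ q ] portOf (chosenAt (tail e)) (φ e) ≡ just q
    parent = portOf-complete (chosenAt (tail e)) {p = tailPort e} chosen-e
    q : Fin (deg (tail e))
    q = proj₁ parent
    eq : portOf (chosenAt (tail e)) (φ e) ≡ just q
    eq = proj₂ parent
    edge-q : edge (tail e) q ≡ e
    edge-q = trans (cong (edge (tail e)) (chosen-injective (tail e)
               (portOf-sound (chosenAt (tail e)) (φ e) eq) chosen-e)) (edge-port (joins e))

  ψ-starForest : IsStarForestDecomposition graph ψ
  ψ-starForest κ = isStarForest {F = λ e → ψ e ≡ κ} (λ {e} {f} → out-unique {e} {f})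
                     (λ e → ψ e Fin.≟ κ) (λ {e} {f} → no-path {e} {f})
    where
    out-unique : ∀ {e f} → ψ e ≡ κ → ψ f ≡ κ → tail e ≡ tail f → e ≡ f
    out-unique {e} {f} ψe ψf = φ-injective chosen-injective {e} {f} (proj₂ (ψ-injective e f (trans ψe (sym ψf))))

    no-path : ∀ {e f} → ψ e ≡ κ → ψ f ≡ κ → head e ≢ tail f
    no-path {e} {f} ψe ψf h≡t = X-tail≢head e (trans (proj₁ same) (cong₂ (X m) (sym h≡t) (sym (proj₂ same))))
      where
      same : X m (tail e) (φ e) ≡ X m (tail f) (φ f) × φ e ≡ φ f
      same = ψ-injective e f (trans ψe (sym ψf))

-- The number of rounds

toℚᵘ-fromℕ : ∀ m → ℚ.toℚᵘ (fromℕ m) ℚᵘ.≃ mkℚᵘ (ℤ.+ m) 0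
toℚᵘ-fromℕ m = ℚ.toℚᵘ-fromℚᵘ (mkℚᵘ (ℤ.+ m) 0)

fromℕ-+ : ∀ m n → fromℕ (m + n) ≡ fromℕ m ℚ.+ fromℕ n
fromℕ-+ m n = ℚ.toℚᵘ-injective (begin-equality
  ℚ.toℚᵘ (fromℕ (m + n))                          ≃⟨ toℚᵘ-fromℕ (m + n) ⟩
  mkℚᵘ (ℤ.+ (m + n)) 0                              ≃⟨ *≡* (cong (ℤ._* ℤ.+ 1) (sym (cong₂ ℤ._+_ (ℤ.*-identityʳ (ℤ.+ m)) (ℤ.*-identityʳ (ℤ.+ n))))) ⟩
  mkℚᵘ (ℤ.+ m) 0 ℚᵘ.+ mkℚᵘ (ℤ.+ n) 0                  ≃⟨ ℚᵘ.+-cong (toℚᵘ-fromℕ m) (toℚᵘ-fromℕ n) ⟨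
  ℚ.toℚᵘ (fromℕ m) ℚᵘ.+ ℚ.toℚᵘ (fromℕ n)          ≃⟨ ℚ.toℚᵘ-homo-+ (fromℕ m) (fromℕ n) ⟨
  ℚ.toℚᵘ (fromℕ m ℚ.+ fromℕ n)                    ∎)
  where open ℚᵘ.≤-Reasoning

fromℕ-* : ∀ m n → fromℕ (m * n) ≡ fromℕ m ℚ.* fromℕ n
fromℕ-* m n = ℚ.toℚᵘ-injective (begin-equality
  ℚ.toℚᵘ (fromℕ (m * n))                          ≃⟨ toℚᵘ-fromℕ (m * n) ⟩
  mkℚᵘ (ℤ.+ (m * n)) 0                              ≃⟨ *≡* (cong (ℤ._* ℤ.+ 1) (ℤ.pos-* m n)) ⟩
  mkℚᵘ (ℤ.+ m) 0 ℚᵘ.* mkℚᵘ (ℤ.+ n) 0                  ≃⟨ ℚᵘ.*-cong (toℚᵘ-fromℕ m) (toℚᵘ-fromℕ n) ⟨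
  ℚ.toℚᵘ (fromℕ m) ℚᵘ.* ℚ.toℚᵘ (fromℕ n)          ≃⟨ ℚ.toℚᵘ-homo-* (fromℕ m) (fromℕ n) ⟨
  ℚ.toℚᵘ (fromℕ m ℚ.* fromℕ n)                    ∎)
  where open ℚᵘ.≤-Reasoning

fromℕ-mono-≤ : ∀ m n → m ≤ n → fromℕ m ℚ.≤ fromℕ n
fromℕ-mono-≤ m n m≤n = ℚ.toℚᵘ-cancel-≤ (begin
  ℚ.toℚᵘ (fromℕ m)   ≃⟨ toℚᵘ-fromℕ m ⟩
  mkℚᵘ (ℤ.+ m) 0     ≤⟨ *≤* (ℤ.*-monoʳ-≤-nonNeg (ℤ.+ 1) (ℤ.+≤+ m≤n)) ⟩
  mkℚᵘ (ℤ.+ n) 0     ≃⟨ toℚᵘ-fromℕ n ⟨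
  ℚ.toℚᵘ (fromℕ n)   ∎)
  where open ℚᵘ.≤-Reasoning

lower<upper : ∀ (x : ℝ) {q r} → q <ℝ x → x ℝ< r → q ℚ.< r
lower<upper x {q} {r} q<x x<r with ℚ.<-cmp q r
... | tri< q<r _ _  = q<r
... | tri≈ _ refl _ = ⊥-elim (ℝ.disjoint x q (q<x , x<r))
... | tri> _ _ r<q  = ⊥-elim (ℝ.disjoint x q (q<x , Equivalence.from (ℝ.upper-rounded x q) (r , r<q , x<r)))

-- With δ = t + 1 - 2a > ε a, peeling shrinks the graph by the factor
-- 2a / (2a + δ) per round, so s = O(1/ε) rounds halve it.  The embedding of ℕ
-- into ℚ is kept abstract, lest the fractions fromℕ m be normalised.
module RoundBound (ι : ℕ → ℚ) (ι-0 : ι 0 ≡ 0ℚ) (ι-1 : ι 1 ≡ 1ℚ)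
                  (ι-+ : ∀ m n → ι (m + n) ≡ ι m ℚ.+ ι n) (ι-* : ∀ m n → ι (m * n) ≡ ι m ℚ.* ι n)
                  (ι-mono-≤ : ∀ m n → m ≤ n → ι m ℚ.≤ ι n)
                  (l a t : ℕ) (1≤l : 1 ≤ l) (ε : ℝ) (0<ε : 0ℚ <ℝ ε) (ε<1 : ε ℝ< 1ℚ)
                  (floor : ∃[ q ] (ε ℝ< q × (ι 2 ℚ.+ q) ℚ.* ι a ℚ.< ι (suc t))) where
  open ℚ.≤-Reasoning

  ι-cancel-< : ∀ {m n} → ι m ℚ.< ι n → m < n
  ι-cancel-< {m} {n} m<n = ≰⇒> λ n≤m → ℚ.<-irrefl refl (ℚ.<-≤-trans m<n (ι-mono-≤ n m n≤m))

  0≤ι : ∀ m → 0ℚ ℚ.≤ ι m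
  0≤ι m = subst (ℚ._≤ ι m) ι-0 (ι-mono-≤ 0 m z≤n)

  *ι-mono-≤ : ∀ m {p q} → p ℚ.≤ q → p ℚ.* ι m ℚ.≤ q ℚ.* ι m
  *ι-mono-≤ m = ℚ.*-monoʳ-≤-nonNeg (ι m) {{ℚ.nonNegative (0≤ι m)}}

  ι*-mono-≤ : ∀ m {p q} → p ℚ.≤ q → ι m ℚ.* p ℚ.≤ ι m ℚ.* q
  ι*-mono-≤ m = ℚ.*-monoˡ-≤-nonNeg (ι m) {{ℚ.nonNegative (0≤ι m)}}

  ι-positive : ∀ m → ℚ.Positive (ι (suc m))
  ι-positive m = ℚ.positive (ℚ.<-≤-trans (ℚ.positive⁻¹ 1ℚ) (subst (ℚ._≤ ι (suc m)) ι-1 (ι-mono-≤ 1 (suc m) (s≤s z≤n))))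

  -- Written as a successor, `δ` is visibly nonzero and can be divided by; `s` is the least number
  -- with s δ > 2a. One block of `s` rounds per halving, and one more, gives the factor `suc l`.
  δ s radius : ℕ
  δ = suc (t ∸ 2 * a)
  s = suc (2 * a / δ)
  radius = suc l * s

  below-floor : ∀ {q} → q <ℝ ε → (ι 2 ℚ.+ q) ℚ.* ι a ℚ.< ι (suc t)
  below-floor q<ε = let q′ , ε<q′ , lt = floor in
    ℚ.≤-<-trans (*ι-mono-≤ a (ℚ.+-monoʳ-≤ (ι 2) (ℚ.<⇒≤ (lower<upper ε q<ε ε<q′)))) lt

  -- The truncated subtraction in `δ` is exact: 0 lies below `ε`, so the floor condition yields 2a <
  -- t + 1.
  2a+δ≡1+t : 2 * a + δ ≡ suc t
  2a+δ≡1+t = trans (+-suc (2 * a) _) (cong suc (m+[n∸m]≡n (s≤s⁻¹ (ι-cancel-< (begin-strict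
    ι (2 * a)                         ≡⟨ ι-* 2 a ⟩
    ι 2 ℚ.* ι a                       ≡⟨ cong (ℚ._* ι a) (ℚ.+-identityʳ (ι 2)) ⟨
    (ι 2 ℚ.+ 0ℚ) ℚ.* ι a              <⟨ below-floor 0<ε ⟩
    ι (suc t)                         ∎)))))

  q*a≤δ : ∀ {q} → q <ℝ ε → q ℚ.* ι a ℚ.≤ ι δ
  q*a≤δ {q} q<ε = ℚ.≮⇒≥ λ δ<qa → ℚ.<-irrefl refl (begin-strict
    ι (suc t)                             ≡⟨ cong ι 2a+δ≡1+t ⟨
    ι (2 * a + δ)                         ≡⟨ ι-+ (2 * a) δ ⟩
    ι (2 * a) ℚ.+ ι δ                     <⟨ ℚ.+-monoʳ-< (ι (2 * a)) δ<qa ⟩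
    ι (2 * a) ℚ.+ q ℚ.* ι a               ≡⟨ cong (ℚ._+ q ℚ.* ι a) (ι-* 2 a) ⟩
    ι 2 ℚ.* ι a ℚ.+ q ℚ.* ι a             ≡⟨ ℚ.*-distribʳ-+ (ι a) (ι 2) q ⟨
    (ι 2 ℚ.+ q) ℚ.* ι a                   <⟨ below-floor q<ε ⟩
    ι (suc t)                             ∎)

  2a<sδ : 2 * a < s * δ
  2a<sδ = subst (_< s * δ) (sym (m≡m%n+[m/n]*n (2 * a) δ)) (+-monoˡ-< (2 * a / δ * δ) (m%n<n (2 * a) δ))

  -- The summand 1 of `s` contributes q ≤ 1. The quotient contributes at most 2, since (2a / δ) q ≤
  -- 2 follows from q a ≤ δ.
  s*q≤3 : ∀ {q} → q <ℝ ε → 0ℚ ℚ.≤ q → ι s ℚ.* q ℚ.≤ ι 3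
  s*q≤3 {q} q<ε 0≤q = begin
    ι s ℚ.* q                             ≡⟨ cong (ℚ._* q) (ι-+ 1 x) ⟩
    (ι 1 ℚ.+ ι x) ℚ.* q                   ≡⟨ ℚ.*-distribʳ-+ q (ι 1) (ι x) ⟩
    ι 1 ℚ.* q ℚ.+ ι x ℚ.* q               ≡⟨ cong (λ y → y ℚ.* q ℚ.+ ι x ℚ.* q) ι-1 ⟩
    1ℚ ℚ.* q ℚ.+ ι x ℚ.* q                ≡⟨ cong (ℚ._+ ι x ℚ.* q) (ℚ.*-identityˡ q) ⟩
    q ℚ.+ ι x ℚ.* q                       ≤⟨ ℚ.+-mono-≤ (ℚ.<⇒≤ (lower<upper ε q<ε ε<1)) x*q≤2 ⟩
    1ℚ ℚ.+ ι 2                            ≡⟨ cong (ℚ._+ ι 2) ι-1 ⟨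
    ι 1 ℚ.+ ι 2                           ≡⟨ ι-+ 1 2 ⟨
    ι 3                                   ∎
    where
    x : ℕ
    x = 2 * a / δ
    x*q≤2 : ι x ℚ.* q ℚ.≤ ι 2
    x*q≤2 = ℚ.*-cancelʳ-≤-pos (ι δ) {{ι-positive (t ∸ 2 * a)}} (begin
      ι x ℚ.* q ℚ.* ι δ                   ≡⟨ ℚ.*-assoc (ι x) q (ι δ) ⟩
      ι x ℚ.* (q ℚ.* ι δ)                 ≡⟨ cong (ι x ℚ.*_) (ℚ.*-comm q (ι δ)) ⟩
      ι x ℚ.* (ι δ ℚ.* q)                 ≡⟨ ℚ.*-assoc (ι x) (ι δ) q ⟨
      ι x ℚ.* ι δ ℚ.* q                   ≡⟨ cong (ℚ._* q) (ι-* x δ) ⟨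
      ι (x * δ) ℚ.* q                     ≤⟨ ℚ.*-monoʳ-≤-nonNeg q {{ℚ.nonNegative 0≤q}} (ι-mono-≤ (x * δ) (2 * a) (m/n*n≤m (2 * a) δ)) ⟩
      ι (2 * a) ℚ.* q                     ≡⟨ cong (ℚ._* q) (ι-* 2 a) ⟩
      ι 2 ℚ.* ι a ℚ.* q                   ≡⟨ ℚ.*-assoc (ι 2) (ι a) q ⟩
      ι 2 ℚ.* (ι a ℚ.* q)                 ≡⟨ cong (ι 2 ℚ.*_) (ℚ.*-comm (ι a) q) ⟩
      ι 2 ℚ.* (q ℚ.* ι a)                 ≤⟨ ι*-mono-≤ 2 (q*a≤δ q<ε) ⟩
      ι 2 ℚ.* ι δ                         ∎)

  -- The peeling accounts for 3 (l + 1) ≤ 6 l. The `e` rounds around it do not depend on `ε`, and q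
  -- < 1 lets them fit under the same bound.
  within : ∀ B {e r} → e ≤ B * l → r ≤ e + radius → ∀ q → q <ℝ ε → ι r ℚ.* q ℚ.≤ ι ((6 + B) * l)
  within B {e} {r} e≤ r≤ q q<ε with ℚ.≤-total q 0ℚ
  -- `Within` quantifies over every rational below `ε`, including those that are not positive.
  ... | inj₁ q≤0 = begin
    ι r ℚ.* q                       ≤⟨ ι*-mono-≤ r q≤0 ⟩
    ι r ℚ.* 0ℚ                      ≡⟨ ℚ.*-zeroʳ (ι r) ⟩
    0ℚ                              ≤⟨ 0≤ι ((6 + B) * l) ⟩
    ι ((6 + B) * l)                 ∎
  ... | inj₂ 0≤q = begin
    ι r ℚ.* q                             ≤⟨ ℚ.*-monoʳ-≤-nonNeg q {{ℚ.nonNegative 0≤q}} (ι-mono-≤ r (e + radius) r≤) ⟩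
    ι (e + radius) ℚ.* q                  ≡⟨ cong (ℚ._* q) (ι-+ e radius) ⟩
    (ι e ℚ.+ ι radius) ℚ.* q              ≡⟨ ℚ.*-distribʳ-+ q (ι e) (ι radius) ⟩
    ι e ℚ.* q ℚ.+ ι radius ℚ.* q          ≤⟨ ℚ.+-mono-≤ e*q≤ radius*q≤ ⟩
    ι (B * l) ℚ.+ ι (suc l * 3)           ≡⟨ ι-+ (B * l) (suc l * 3) ⟨
    ι (B * l + suc l * 3)                 ≤⟨ ι-mono-≤ (B * l + suc l * 3) ((6 + B) * l) (≤-trans (+-monoʳ-≤ (B * l) 3+3l≤6l) (≤-reflexive (regroup B l))) ⟩
    ι ((6 + B) * l)                       ∎
    where
    e*q≤ : ι e ℚ.* q ℚ.≤ ι (B * l)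
    e*q≤ = begin
      ι e ℚ.* q         ≤⟨ ι*-mono-≤ e (ℚ.<⇒≤ (lower<upper ε q<ε ε<1)) ⟩
      ι e ℚ.* 1ℚ        ≡⟨ ℚ.*-identityʳ (ι e) ⟩
      ι e               ≤⟨ ι-mono-≤ e (B * l) e≤ ⟩
      ι (B * l)         ∎

    radius*q≤ : ι radius ℚ.* q ℚ.≤ ι (suc l * 3)
    radius*q≤ = begin
      ι radius ℚ.* q                ≡⟨ cong (ℚ._* q) (ι-* (suc l) s) ⟩
      ι (suc l) ℚ.* ι s ℚ.* q       ≡⟨ ℚ.*-assoc (ι (suc l)) (ι s) q ⟩
      ι (suc l) ℚ.* (ι s ℚ.* q)     ≤⟨ ι*-mono-≤ (suc l) (s*q≤3 q<ε 0≤q) ⟩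
      ι (suc l) ℚ.* ι 3             ≡⟨ ι-* (suc l) 3 ⟨
      ι (suc l * 3)                 ∎

    3+3l≤6l : suc l * 3 ≤ 6 * l
    3+3l≤6l = ≤-trans (+-monoˡ-≤ (l * 3) (*-monoˡ-≤ 3 1≤l)) (≤-reflexive (double l))
      where
      double : ∀ l → l * 3 + l * 3 ≡ 6 * l
      double = solve-∀

    regroup : ∀ B l → B * l + 6 * l ≡ (6 + B) * l
    regroup = solve-∀

-- The four algorithms

module Solutions {c n a t s δ : ℕ} (δ-def : 2 * a + δ ≡ suc t) (s-large : 2 * a < s * δ) where

  i : ℕ
  i = suc (log n) * s

  -- Every vertex is removed within `i` rounds and has level below `i`, so `mod` only makes the
  -- output total.
  hPartitionAlgorithm : Algorithm ⊤ (λ _ → Fin (suc i))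
  hPartitionAlgorithm = viewAlgorithm i λ _ v → level t v mod suc i

  hPartition-correct : (N : Network c n) → let open Network N in
                       ∀ {a*} → IsPseudoArboricity graph a* → a* ≤ a →
                       IsHPartition graph t (run hPartitionAlgorithm N (λ _ → tt))
  hPartition-correct N pa a*≤a v = ≤-trans
    (#-mono _ (laterEdge? t {i} dead v) λ (inc , ≤₁ , ≤₂) →
      inc , subst₂ _≤_ (class v) (class _) ≤₁ , subst₂ _≤_ (class v) (class _) ≤₂)
    (laterEdges≤t t {i} dead v)
    where
    open Views i (λ _ v → level t v mod suc i) N (λ _ → tt)
    dead : ∀ v → ¬ Alive t i v
    dead = peeled t s (proj₁ pa) a*≤a δ-def s-large
    class : ∀ v → toℕ (lev t i v mod suc i) ≡ lev t i v
    class v = trans (Fin.toℕ-fromℕ< (m%n<n (lev t i v) (suc i)))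
                    (m<n⇒m%n≡m (m<n⇒m<1+n (proj₁ (dead-level t i (dead v)))))

  orientationOutput : ∀ d → View ⊤ d → Fin d → Bool
  orientationOutput _ = LocalOrientation.outgoing t

  orientationAlgorithm : Algorithm ⊤ (λ d → Fin d → Bool)
  orientationAlgorithm = viewAlgorithm (suc i) orientationOutput

  orientation-correct : (N : Network c n) → let open Network N in
                        ∀ {a*} → IsPseudoArboricity graph a* → a* ≤ a →
                        Σ (Orientation graph) λ o → ReportsOrientation N (run orientationAlgorithm N (λ _ → tt)) o
                          × Orientation.Acyclic o × (∀ v → Orientation.outdegree o v ≤ t)
  orientation-correct N pa a*≤a = orientation , outgoing⇔tail , acyclic , outdegree≤t
    where
    open Views (suc i) orientationOutput N (λ _ → tt)
    open OrientedViews (suc i) orientationOutput N (λ _ → tt) t i (peeled t s (proj₁ pa) a*≤a δ-def s-large)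

  fromTails : ∀ {Label A : Set} → (∀ {d} → View Label d → Fin d → Maybe A) → ∀ d → View Label d → Fin d → Maybe A
  fromTails g _ (leaf _ _)     _ = nothing
  fromTails g _ (node v _ w q) p = g v p <∣> g (w p) (q p)

  starForestOutput : ℕ → ∀ d → View ⊤ d → Fin d → Maybe (Fin (3 * t))
  starForestOutput m = fromTails (λ v → edgeColor (LocalColoring.colors t m m v))

  starForestAlgorithm : ℕ → Algorithm ⊤ (λ d → Fin d → Maybe (Fin (3 * t)))
  starForestAlgorithm m = viewAlgorithm (suc (m * 2 + (2 + i))) (starForestOutput m)

  starForest-correct : (N : Network c n) → let open Network N in
                       ∀ {a*} → IsPseudoArboricity graph a* → a* ≤ a →
                       ∀ m → (∀ v → 3 * length (id v) ≤ m) →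
                       Σ (Edge → Fin (3 * t)) λ φ → ReportsColoring N (run (starForestAlgorithm m) N (λ _ → tt)) φ
                         × IsStarForestDecomposition graph φ
  starForest-correct N pa a*≤a m id-short = ψ , ψ-reports , ψ-starForest
    where
    open Views (suc (m * 2 + (2 + i))) (starForestOutput m) N (λ _ → tt)
    open ColoredViews (suc (m * 2 + (2 + i))) (starForestOutput m) N (λ _ → tt) t i
           (peeled t s (proj₁ pa) a*≤a δ-def s-large) m id-short

  module _ {Color : Set} (_≟_ : DecidableEquality Color) where

    listForestOutput : ∀ d → View (List Color) d → Fin d → Maybe Color
    listForestOutput = fromTails (LocalOrientation.chosen t _≟_ (λ Q → Q))

    listForestAlgorithm : Algorithm (List Color) (λ d → Fin d → Maybe Color)
    listForestAlgorithm = viewAlgorithm (suc (suc i)) listForestOutput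

    listForest-correct : (N : Network c n) → let open Network N in
                         ∀ {a*} → IsPseudoArboricity graph a* → a* ≤ a →
                         (Q : Edge → List Color) → (∀ e → Unique (Q e) × length (Q e) ≡ t) →
                         Σ (Edge → Color) λ φ → ReportsColoring N (run listForestAlgorithm N Q) φ
                           × IsListForestDecomposition graph Q φ
    listForest-correct N pa a*≤a Q palettes = φ , φ-reports , chosen-listForest
      where
      open Views (suc (suc i)) listForestOutput N Q
      open OrientedViews (suc (suc i)) listForestOutput N Q t i (peeled t s (proj₁ pa) a*≤a δ-def s-large)
      open Chosen _≟_ (λ Q → Q) palettes

theorem1p4 : (c : ℕ) → ∃[ C ] ((n a t : ℕ) (ε : ℝ) → 0ℚ <ℝ ε → ε ℝ< 1ℚ → IsFloor t ε a →
    (∃[ k ] (Within C n ε k ×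
    Σ (Algorithm ⊤ (λ d → Fin k)) λ A → Within C n ε (Algorithm.rounds A) ×
    ((N : Network c n) → let open Network N in
    ∀ a* → IsPseudoArboricity graph a* → a* ≤ a →
    IsHPartition graph t (run A N (λ e → tt)))))
    × (Σ (Algorithm ⊤ (λ d → Fin d → Bool)) λ A → Within C n ε (Algorithm.rounds A) ×
    ((N : Network c n) → let open Network N in
    ∀ a* → IsPseudoArboricity graph a* → a* ≤ a →
    Σ (Orientation graph) λ o → ReportsOrientation N (run A N (λ e → tt)) o
    × Orientation.Acyclic o × (∀ v → Orientation.outdegree o v ≤ t)))
    × (Σ (Algorithm ⊤ (λ d → Fin d → Maybe (Fin (3 * t)))) λ A → Within C n ε (Algorithm.rounds A) ×
    ((N : Network c n) → let open Network N in
    ∀ a* → IsPseudoArboricity graph a* → a* ≤ a →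
    Σ (Edge → Fin (3 * t)) λ φ → ReportsColoring N (run A N (λ e → tt)) φ
    × IsStarForestDecomposition graph φ))
    × ((Color : Set) → DecidableEquality Color →
    Σ (Algorithm (List Color) (λ d → Fin d → Maybe Color)) λ A → Within C n ε (Algorithm.rounds A) ×
    ((N : Network c n) → let open Network N in
    ∀ a* → IsPseudoArboricity graph a* → a* ≤ a →
    (Q : Edge → List Color) → (∀ e → Unique (Q e) × length (Q e) ≡ t) →
    Σ (Edge → Color) λ φ → ReportsColoring N (run A N Q) φ
    × IsListForestDecomposition graph Q φ)))
theorem1p4 c = 6 + B , λ n a t ε 0<ε ε<1 floor →
  let open RoundBound fromℕ refl refl fromℕ-+ fromℕ-* fromℕ-mono-≤ (log n) a t (1≤log n) ε 0<ε ε<1 (proj₂ floor)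
      open Solutions {c} {n} {a} {t} {s} 2a+δ≡1+t 2a<sδ
      m = 3 * (c * log n)
      small : ∀ {e} → e ≤ 3 → e ≤ B * log n
      small e≤3 = ≤-trans e≤3 (*-mono-≤ (m≤m+n 3 (6 * c)) (1≤log n))
  in (suc i , within B (small {1} (s≤s z≤n)) ≤-refl , hPartitionAlgorithm
             , within B (small {0} z≤n) ≤-refl , λ N a* → hPartition-correct N {a*})
   , (orientationAlgorithm , within B (small {1} (s≤s z≤n)) ≤-refl , λ N a* → orientation-correct N {a*})
   , (starForestAlgorithm m
     , within B (star-rounds (1≤log n)) (≤-reflexive (cong suc (sym (+-assoc (m * 2) 2 i))))
     , λ N a* pa a*≤a → starForest-correct N pa a*≤a m (λ v → *-monoʳ-≤ 3 (Network.id-length N v)))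
   , λ Color _≟_ → listForestAlgorithm _≟_ , within B (small {2} (s≤s (s≤s z≤n))) ≤-refl
                 , λ N a* → listForest-correct _≟_ N {a*}
  where
  -- The star-forests are the costliest: m = 3 c log n stages of two rounds give 6 c log n, and
  -- three rounds more surround the peeling and the stages.
  B : ℕ
  B = 3 + 6 * c

  star-rounds : ∀ {l} → 1 ≤ l → suc (3 * (c * l) * 2 + 2) ≤ B * l
  star-rounds {l} 1≤l = begin
    suc (3 * (c * l) * 2 + 2)   ≡⟨ regroup c l ⟩
    3 * 1 + 6 * c * l           ≤⟨ +-monoˡ-≤ (6 * c * l) (*-monoʳ-≤ 3 1≤l) ⟩
    3 * l + 6 * c * l           ≡⟨ *-distribʳ-+ l 3 (6 * c) ⟨
    B * l                       ∎
    where
    open ≤-Reasoning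
    regroup : ∀ c l → suc (3 * (c * l) * 2 + 2) ≡ 3 * 1 + 6 * c * l
    regroup = solve-∀
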